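{- Let $d=(d_1,\ldots,d_n)$ be a degree sequence with $n\ge 4$, and let $m=\frac12\sum_i d_i$. There is a realization of $d$ as a bridge-less bipartite cactus if and only if $m\le 2\left\lfloor\frac{2(n-1)}{3}\right\rfloor$, $m$ is even, and $d_i$ is even for every $i$.
   Context: A degree sequence is a sequence $d=(d_1,\ldots,d_n)$ of integers with $d_i\in\{1,\ldots,n-1\}$, even sum, and $d_1\ge\cdots\ge d_n$. A realization of $d$ is a simple graph on $\{1,\ldots,n\}$ in which vertex $i$ has degree $d_i$. A cactus is a connected simple graph in which every edge lies on at most one cycle; it is bridge-less if no edge's removal disconnects it. -}

module Defs where

open import Data.Bool.Base using (Bool)
open import Data.Fin.Base as Fin using (Fin)
open import Data.Fin.Properties using (_≟_)
open import Data.List.Base using (List; _∷_; _∷ʳ_; length; filter; allFin)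
open import Data.List.Relation.Unary.Linked using (Linked)
open import Data.List.Relation.Unary.Unique.Propositional using (Unique)
open import Data.Nat.Base using (ℕ; _≤_; _∸_; _/_)
open import Data.Nat.Divisibility using (_∣_)
open import Data.Product using (_×_; _,_; proj₁; ∃)
open import Data.Sum.Base using (_⊎_; swap)
open import Data.Vec.Base using (Vec; lookup; sum)
open import Function.Base using (_∘_)
open import Function.Bundles using (_⇔_)
open import Level using (0ℓ)
open import Relation.Binary.Construct.Closure.ReflexiveTransitive using (Star)
open import Relation.Binary.Core using (Rel)
open import Relation.Binary.Definitions using (Symmetric; Irreflexive; Decidable)
open import Relation.Binary.PropositionalEquality using (_≡_; _≢_)
open import Relation.Nullary.Decidable using (_×-dec_; _⊎-dec_; ¬?)
open import Relation.Nullary.Negation using (¬_)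

record IsDegreeSequence {n : ℕ} (d : Vec ℕ n) : Set where
  field
    positive      : ∀ i → 1 ≤ lookup d i
    bounded       : ∀ i → lookup d i ≤ n ∸ 1
    even-sum      : 2 ∣ sum d
    nonincreasing : ∀ {i j} → i Fin.≤ j → lookup d j ≤ lookup d i

-- Exact whenever the sum is even, in particular for degree sequences.
halfSum : ∀ {n} → Vec ℕ n → ℕ
halfSum d = sum d / 2

record SimpleGraph (n : ℕ) : Set₁ where
  field
    Adj    : Rel (Fin n) 0ℓ
    adj?   : Decidable Adj
    symm   : Symmetric Adj
    irrefl : Irreflexive _≡_ Adj

open SimpleGraph public

module _ {n : ℕ} where

  degree : SimpleGraph n → Fin n → ℕ
  degree G v = length (filter (adj? G v) (allFin n))

  Realizes : SimpleGraph n → Vec ℕ n → Set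
  Realizes G d = ∀ i → degree G i ≡ lookup d i

  Connected : SimpleGraph n → Set
  Connected G = ∀ u v → Star (Adj G) u v

  SameEdge : (u v x y : Fin n) → Set
  SameEdge u v x y = (x ≡ u × y ≡ v) ⊎ (y ≡ u × x ≡ v)

  sameEdge? : ∀ u v → Decidable (SameEdge u v)
  sameEdge? u v x y = (x ≟ u ×-dec y ≟ v) ⊎-dec (y ≟ u ×-dec x ≟ v)

  deleteEdge : SimpleGraph n → Fin n → Fin n → SimpleGraph n
  deleteEdge G u v = record
    { Adj    = λ x y → Adj G x y × ¬ SameEdge u v x y
    ; adj?   = λ x y → adj? G x y ×-dec ¬? (sameEdge? u v x y)
    ; symm   = λ (a , ne) → symm G a , ne ∘ swap
    ; irrefl = λ eq → irrefl G eq ∘ proj₁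
    }

  -- Only meaningful for connected G.
  Bridgeless : SimpleGraph n → Set
  Bridgeless G = ∀ u v → Adj G u v → Connected (deleteEdge G u v)

  Bipartite : SimpleGraph n → Set
  Bipartite G = ∃ λ (colour : Fin n → Bool) → ∀ u v → Adj G u v → colour u ≢ colour v

data Consecutive {A : Set} (x y : A) : List A → Set where
  here  : ∀ {zs} → Consecutive x y (x ∷ y ∷ zs)
  there : ∀ {z zs} → Consecutive x y zs → Consecutive x y (z ∷ zs)

-- A cycle presented with a base point and an orientation; the cycle itself,
-- as a subgraph, is determined by its edge set (see SameCycle).
record Cycle {n : ℕ} (G : SimpleGraph n) : Set where
  field
    start : Fin n
    rest  : List (Fin n)

  closedWalk : List (Fin n)
  closedWalk = start ∷ rest ∷ʳ start

  field
    distinct : Unique (start ∷ rest)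
    length≥3 : 3 ≤ length (start ∷ rest)
    adjacent : Linked (Adj G) closedWalk

module _ {n : ℕ} {G : SimpleGraph n} where

  LiesOn : Fin n → Fin n → Cycle G → Set
  LiesOn u v C = Consecutive u v (Cycle.closedWalk C) ⊎ Consecutive v u (Cycle.closedWalk C)

  SameCycle : Cycle G → Cycle G → Set
  SameCycle C D = ∀ x y → LiesOn x y C ⇔ LiesOn x y D

record IsCactus {n : ℕ} (G : SimpleGraph n) : Set where
  field
    connected         : Connected G
    at-most-one-cycle : ∀ u v → Adj G u v → (C D : Cycle G) →
                        LiesOn u v C → LiesOn u v D → SameCycle C D

{-# OPTIONS --safe #-}

-- Necessity.  In a bridgeless cactus the two edges at v of a common cycle are
-- paired by a fixed-point-free involution, so all degrees are even; summing the
-- degrees over one colour class shows that m is even.  For the bound, take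
-- breadth-first levels.  Every edge joins consecutive levels, so m = (n - 1) + t,
-- where t counts the pairs (v , w) with w above v other than the parent of v.
-- The fundamental cycle of (v , w) contains the tree edges above v, w and the
-- parent of v.  Distinct fundamental cycles share no edge, hence 3t ≤ n - 1,
-- that is 3m ≤ 4(n - 1).
--
-- Sufficiency.  Write d i = 2 (1 + e i) and q = ∑ e.  The hypotheses say that
-- n = 3q + L with L ≥ 4 even.  Start from a cycle of length L and attach q
-- four-cycles, each time at a vertex whose degree is still too small.
module Submission where

open import Data.Bool.Base as Bool using (Bool; true; false; not; if_then_else_)
open import Data.Bool.Properties as Bool using (¬-not; not-¬; not-involutive)
open import Data.Empty using (⊥)
open import Data.Fin.Base as Fin using (Fin; zero; suc; toℕ; fromℕ; inject₁; opposite)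
open import Data.Fin.Induction using (<-weakInduction; >-weakInduction)
open import Data.Fin.Patterns using (0F; 1F; 2F)
open import Data.Fin.Permutation using (reverse)
open import Data.Fin.Properties as Fin using (_≟_; any?; toℕ-inject₁; toℕ-fromℕ; opposite-involutive; opposite-prop)
open import Data.Fin.Relation.Unary.Top using (view; ‵fromℕ; ‵inject₁; view-fromℕ; view-inject₁)
open import Data.List.Base using (List; []; _∷_; _++_; _∷ʳ_; length; map; filter; tabulate; initLast; _∷ʳ′_)
open import Data.List.Membership.DecPropositional using (_∈?_)
open import Data.List.Membership.Propositional using (_∈_; _∉_; find)
open import Data.List.Membership.Propositional.Properties using (∈-++⁺ʳ; ∈-++⁻)
open import Data.List.Properties using (length-++; ++-assoc; length-map; map-++; ++-identityʳ)
open import Data.List.Relation.Unary.All as All using (All; []; _∷_)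
import Data.List.Relation.Unary.All.Properties as All
open import Data.List.Relation.Unary.AllPairs using ([]; _∷_)
import Data.List.Relation.Unary.AllPairs.Properties as AllPairs
open import Data.List.Relation.Unary.Any as Any using (here; there)
open import Data.List.Relation.Unary.Linked as Linked using (Linked; [-]; _∷_)
import Data.List.Relation.Unary.Linked.Properties as Linked
open import Data.List.Relation.Unary.Unique.Propositional using (Unique)
import Data.List.Relation.Unary.Unique.Propositional.Properties as Unique
open import Data.Nat.Base
open import Data.Nat.Divisibility using (_∣_; divides; divides-refl; _∣0; ∣m∣n⇒∣m+n; ∣m+n∣m⇒∣n)
open import Data.Nat.DivMod using (/-monoˡ-≤; m*n/n≡m; m/n*n≤m)
open import Data.Nat.Properties hiding (_≟_)
import Data.Nat.Properties as ℕ
open import Data.Nat.Tactic.RingSolver using (solve-∀)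
open import Data.Product using (_×_; _,_; proj₁; proj₂; ∃; ∃₂)
open import Data.Sum.Base using (_⊎_; inj₁; inj₂; [_,_]′; swap)
open import Data.Unit.Base using (⊤; tt)
open import Data.Vec.Base as Vec using (Vec; lookup)
open import Function.Base using (_∘_; id)
open import Function.Bundles using (_⇔_; mk⇔; Equivalence)
open import Function.Definitions using (Injective)
open import Level using (0ℓ)
open import Relation.Binary.Construct.Closure.ReflexiveTransitive as Star using (Star; ε; _◅_; _◅◅_; gmap)
open import Relation.Binary.Core using (Rel)
open import Relation.Binary.Definitions using (Decidable; tri<; tri≈; tri>)
open import Relation.Binary.PropositionalEquality
open import Relation.Nullary.Decidable using (Dec; yes; no; does; _×-dec_; _⊎-dec_; ¬?; False; toWitnessFalse)
open import Relation.Nullary.Negation using (¬_; contradiction)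
open import Relation.Unary using (Pred) renaming (Decidable to Decidable₁)
open import Algebra.Properties.CommutativeMonoid.Sum +-0-commutativeMonoid using (sum; ∑-distrib-+; ∑-comm; sum-cong-≗; sum-replicate-zero; sum-permute)
open import Algebra.Properties.Semiring.Sum +-*-semiring using (*-distribˡ-sum)
open import Defs

-- Counting with indicators

-- For necessity no block decomposition is built: the cactus property enters only through pairs of
-- explicit cycles with a common edge, whose edge sets are then compared at a single vertex.
-- Bipartiteness excludes edges inside a level, so `w` and `parent v` share a level; being distinct,
-- neither is the root. This is why a non-tree pair always pays with three tree edges. Evenness of m
-- = 2k then turns 3m ≤ 4(n - 1) into 3k ≤ 2(n - 1), the origin of the floor. Conversely m = n + q,
-- so the bound on m reads 3q + 4 ≤ n, and L = n - 3q = m - 4q inherits the parity of m. The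
-- obstacle in the construction is the labelling: every vertex has its own prescribed degree, so the
-- new vertices must occupy positions where the sequence asks for degree two. Keeping the excesses
-- sorted, and always attaching at the first vertex of positive excess, makes the leading positions
-- available at every stage.

𝟙 : {P : Set} → Dec P → ℕ
𝟙 P? = if does P? then 1 else 0

module _ {P : Set} where

  𝟙-true : (P? : Dec P) → P → 𝟙 P? ≡ 1
  𝟙-true (yes _) _ = refl
  𝟙-true (no ¬p) p = contradiction p ¬p

  𝟙-false : (P? : Dec P) → ¬ P → 𝟙 P? ≡ 0
  𝟙-false (yes p) ¬p = contradiction p ¬p
  𝟙-false (no _)  _  = refl

𝟙-cong : {P Q : Set} (P? : Dec P) (Q? : Dec Q) → (P → Q) → (Q → P) → 𝟙 P? ≡ 𝟙 Q?
𝟙-cong (yes p) Q? f g = sym (𝟙-true Q? (f p))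
𝟙-cong (no ¬p) Q? f g = sym (𝟙-false Q? (¬p ∘ g))

𝟙-⊎ : {P Q R : Set} (R? : Dec R) (P? : Dec P) (Q? : Dec Q) →
      (R → P ⊎ Q) → (P → R) → (Q → R) → (P → ¬ Q) → 𝟙 R? ≡ 𝟙 P? + 𝟙 Q?
𝟙-⊎ R? (yes p) (yes q) f g h e = contradiction q (e p)
𝟙-⊎ R? (yes p) (no ¬q) f g h e = 𝟙-true R? (g p)
𝟙-⊎ R? (no ¬p) (yes q) f g h e = 𝟙-true R? (h q)
𝟙-⊎ R? (no ¬p) (no ¬q) f g h e = 𝟙-false R? ([ ¬p , ¬q ]′ ∘ f)

module _ {n : ℕ} where

  sum-zero : (f : Fin n → ℕ) → (∀ i → f i ≡ 0) → sum f ≡ 0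
  sum-zero f f≡0 = trans (sum-cong-≗ f≡0) (sum-replicate-zero n)

sum-mono : ∀ {n} {f g : Fin n → ℕ} → (∀ i → f i ≤ g i) → sum f ≤ sum g
sum-mono {zero}  f≤g = z≤n
sum-mono {suc n} f≤g = +-mono-≤ (f≤g zero) (sum-mono (f≤g ∘ suc))

sum-const : ∀ n k → sum {n} (λ _ → k) ≡ n * k
sum-const zero    k = refl
sum-const (suc n) k = cong (k +_) (sum-const n k)

∣-sum : ∀ {n} k {f : Fin n → ℕ} → (∀ i → k ∣ f i) → k ∣ sum f
∣-sum {zero}  k k∣f = k ∣0
∣-sum {suc n} k k∣f = ∣m∣n⇒∣m+n (k∣f zero) (∣-sum k (k∣f ∘ suc))

sum-𝟙-unique : ∀ {n} {P : Pred (Fin n) 0ℓ} (P? : Decidable₁ P) a →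
               P a → (∀ i → P i → i ≡ a) → sum (λ i → 𝟙 (P? i)) ≡ 1
sum-𝟙-unique P? zero Pa uniq =
  cong₂ _+_ (𝟙-true (P? zero) Pa)
    (sum-zero _ λ i → 𝟙-false (P? (suc i)) (λ Pi → contradiction (uniq (suc i) Pi) λ ()))
sum-𝟙-unique P? (suc a) Pa uniq =
  cong₂ _+_ (𝟙-false (P? zero) (λ P0 → contradiction (uniq zero P0) λ ()))
    (sum-𝟙-unique (P? ∘ suc) a Pa (λ i Pi → Fin.suc-injective (uniq (suc i) Pi)))

sum-𝟙-≡ : ∀ {n} (a : Fin n) → sum (λ i → 𝟙 (i ≟ a)) ≡ 1
sum-𝟙-≡ a = sum-𝟙-unique (_≟ a) a refl (λ _ → id)

length-filter-tabulate : ∀ {n} {A : Set} {P : Pred A 0ℓ} (P? : Decidable₁ P) (f : Fin n → A) →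
                         length (filter P? (tabulate f)) ≡ sum (λ i → 𝟙 (P? (f i)))
length-filter-tabulate {zero}  P? f = refl
length-filter-tabulate {suc n} P? f with does (P? (f zero))
... | true  = cong suc (length-filter-tabulate P? (f ∘ suc))
... | false = length-filter-tabulate P? (f ∘ suc)

degree-sum : ∀ {n} (G : SimpleGraph n) v → degree G v ≡ sum (λ w → 𝟙 (adj? G v w))
degree-sum G v = length-filter-tabulate (adj? G v) id

sum-lookup : ∀ {n} (d : Vec ℕ n) → Vec.sum d ≡ sum (lookup d)
sum-lookup Vec.[]       = refl
sum-lookup (x Vec.∷ xs) = cong (x +_) (sum-lookup xs)

module _ {n : ℕ} {R O : Rel (Fin n) 0ℓ} (R? : Decidable R) (O? : Decidable O) where

  -- Each related pair is oriented in exactly one of two ways, so the indicator of `R` is that of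
  -- `O` plus its transpose, and exchanging the sums shows that both parts have the same total.
  -- Orientations by the order of `Fin`, by colour and by level are all instances.
  sum-orientation : (∀ v w → R v w → O v w ⊎ O w v) → (∀ v w → O v w → R v w) →
                    (∀ v w → O w v → R v w) → (∀ v w → O v w → ¬ O w v) →
                    sum (λ v → sum λ w → 𝟙 (R? v w)) ≡ 2 * sum (λ v → sum λ w → 𝟙 (O? v w))
  sum-orientation split fwd bwd excl = begin
    sum (λ v → sum λ w → 𝟙 (R? v w))
      ≡⟨ sum-cong-≗ (λ v → sum-cong-≗ λ w →
           𝟙-⊎ (R? v w) (O? v w) (O? w v) (split v w) (fwd v w) (bwd v w) (excl v w)) ⟩
    sum (λ v → sum λ w → 𝟙 (O? v w) + 𝟙 (O? w v))
      ≡⟨ sum-cong-≗ (λ v → ∑-distrib-+ (λ w → 𝟙 (O? v w)) (λ w → 𝟙 (O? w v))) ⟩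
    sum (λ v → sum (λ w → 𝟙 (O? v w)) + sum (λ w → 𝟙 (O? w v)))
      ≡⟨ ∑-distrib-+ (λ v → sum λ w → 𝟙 (O? v w)) (λ v → sum λ w → 𝟙 (O? w v)) ⟩
    S + sum (λ v → sum λ w → 𝟙 (O? w v))
      ≡⟨ cong (S +_) (∑-comm (λ v w → 𝟙 (O? w v))) ⟩
    S + S
      ≡⟨ cong (S +_) (sym (+-identityʳ S)) ⟩
    2 * S ∎
    where
    open ≡-Reasoning
    S = sum (λ v → sum λ w → 𝟙 (O? v w))

module _ {n : ℕ} {P : Pred (Fin n) 0ℓ} (P? : Decidable₁ P) (g : Fin n → Fin n) where

  -- On `P` the graph of `g` is a symmetric relation without loops in which every element has
  -- exactly one partner. Orienting each pair by the order of `Fin` halves its size.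
  involution⇒even : (∀ w → P w → P (g w)) → (∀ w → P w → g w ≢ w) → (∀ w → P w → g (g w) ≡ w) →
                    2 ∣ sum (λ w → 𝟙 (P? w))
  involution⇒even closed fpf invol = divides (sum λ w → sum λ x → 𝟙 (O? w x)) (begin
    sum (λ w → 𝟙 (P? w))
      ≡⟨ sum-cong-≗ row ⟩
    sum (λ w → sum λ x → 𝟙 (R? w x))
      ≡⟨ sum-orientation R? O? split (λ _ _ → proj₁)
           (λ v w ((Pw , gw≡v) , _) → R-sym Pw gw≡v)
           (λ v w (_ , v<w) (_ , w<v) → <-asym v<w w<v) ⟩
    2 * sum (λ w → sum λ x → 𝟙 (O? w x))
      ≡⟨ *-comm 2 (sum λ w → sum λ x → 𝟙 (O? w x)) ⟩
    sum (λ w → sum λ x → 𝟙 (O? w x)) * 2 ∎)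
    where
    open ≡-Reasoning
    R O : Rel (Fin n) 0ℓ
    R w x = P w × g w ≡ x
    O w x = R w x × w Fin.< x
    R? : Decidable R
    R? w x = P? w ×-dec g w ≟ x
    O? : Decidable O
    O? w x = R? w x ×-dec w Fin.<? x
    R-sym : ∀ {w x} → P w → g w ≡ x → R x w
    R-sym {w} Pw refl = closed w Pw , invol w Pw
    split : ∀ w x → R w x → O w x ⊎ O x w
    split w x r@(Pw , gw≡x) with Fin.<-cmp w x
    ... | tri< w<x _ _ = inj₁ (r , w<x)
    ... | tri≈ _ w≡x _ = contradiction (trans gw≡x (sym w≡x)) (fpf w Pw)
    ... | tri> _ _ x<w = inj₂ (R-sym Pw gw≡x , x<w)
    row : ∀ w → 𝟙 (P? w) ≡ sum (λ x → 𝟙 (R? w x))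
    row w with P? w
    ... | yes Pw = sym (trans (sum-cong-≗ λ x → 𝟙-cong (yes Pw ×-dec g w ≟ x) (x ≟ g w)
                                 (sym ∘ proj₂) (λ e → Pw , sym e)) (sum-𝟙-≡ (g w)))
    ... | no ¬Pw = sym (sum-zero _ λ x → 𝟙-false (no ¬Pw ×-dec g w ≟ x) (¬Pw ∘ proj₁))

-- Consecutive entries of lists

module _ {A : Set} {x y : A} where

  consecutive-++ˡ : ∀ {xs} ys → Consecutive x y xs → Consecutive x y (xs ++ ys)
  consecutive-++ˡ ys here      = here
  consecutive-++ˡ ys (there c) = there (consecutive-++ˡ ys c)

  consecutive-last : ∀ xs → Consecutive x y (xs ∷ʳ x ∷ʳ y)
  consecutive-last []       = here
  consecutive-last (_ ∷ xs) = there (consecutive-last xs)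

  consecutive-∷ʳ⁻ : ∀ xs {a b} → Consecutive x y (xs ∷ʳ a ∷ʳ b) →
                    Consecutive x y (xs ∷ʳ a) ⊎ (x ≡ a × y ≡ b)
  consecutive-∷ʳ⁻ [] here = inj₂ (refl , refl)
  consecutive-∷ʳ⁻ [] (there (there ()))
  consecutive-∷ʳ⁻ (_ ∷ []) here = inj₁ here
  consecutive-∷ʳ⁻ (_ ∷ _ ∷ xs) here = inj₁ here
  consecutive-∷ʳ⁻ (_ ∷ xs) (there c) with consecutive-∷ʳ⁻ xs c
  ... | inj₁ c′ = inj₁ (there c′)
  ... | inj₂ e  = inj₂ e

  consecutive⇒∈-init : ∀ xs {a} → Consecutive x y (xs ∷ʳ a) → x ∈ xs
  consecutive⇒∈-init [] (there ())
  consecutive⇒∈-init (_ ∷ [])     here  = here refl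
  consecutive⇒∈-init (_ ∷ _ ∷ xs) here  = here refl
  consecutive⇒∈-init (_ ∷ xs) (there c) = there (consecutive⇒∈-init xs c)

  consecutive⇒∈ : ∀ {xs} → Consecutive x y xs → y ∈ xs
  consecutive⇒∈ here      = there (here refl)
  consecutive⇒∈ (there c) = there (consecutive⇒∈ c)

  consecutive⇒∈-tail : ∀ {a xs} → Consecutive x y (a ∷ xs) → y ∈ xs
  consecutive⇒∈-tail here      = here refl
  consecutive⇒∈-tail (there c) = consecutive⇒∈ c

  linked-consecutive : ∀ {R : Rel A 0ℓ} {xs} → Linked R xs → Consecutive x y xs → R x y
  linked-consecutive (r ∷ _)  here      = r
  linked-consecutive (_ ∷ rs) (there c) = linked-consecutive rs c

linked-∷ʳ : {A : Set} {R : Rel A 0ℓ} → ∀ xs {x y} →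
            Linked R (xs ∷ʳ x) → R x y → Linked R (xs ∷ʳ x ∷ʳ y)
linked-∷ʳ []           [-]      r = r ∷ [-]
linked-∷ʳ (_ ∷ [])     (s ∷ rs) r = s ∷ linked-∷ʳ [] rs r
linked-∷ʳ (_ ∷ _ ∷ xs) (s ∷ rs) r = s ∷ linked-∷ʳ (_ ∷ xs) rs r

unique-∷ʳ : {A : Set} → ∀ {x : A} {xs} → Unique xs → All (x ≢_) xs → Unique (xs ∷ʳ x)
unique-∷ʳ u x≢ = AllPairs.++⁺ u ([] ∷ []) (All.map (λ x≢y → x≢y ∘ sym ∷ []) x≢)

∈-∷ʳ⇒∈-∷ : {A : Set} {x s : A} → ∀ r → x ∈ r ∷ʳ s → x ∈ s ∷ r
∈-∷ʳ⇒∈-∷ r x∈ with ∈-++⁻ r x∈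
... | inj₁ x∈r         = there x∈r
... | inj₂ (here refl) = here refl

-- Vertices and edges of a cycle

module _ {n : ℕ} {G : SimpleGraph n} where

  vertices : Cycle G → List (Fin n)
  vertices C = Cycle.start C ∷ Cycle.rest C

  liesOn⇒∈ : ∀ (C : Cycle G) {x y} → LiesOn x y C → x ∈ vertices C
  liesOn⇒∈ C (inj₁ c) = consecutive⇒∈-init (vertices C) c
  liesOn⇒∈ C (inj₂ c) = ∈-∷ʳ⇒∈-∷ (Cycle.rest C) (consecutive⇒∈-tail c)

  liesOn⇒adj : ∀ (C : Cycle G) {x y} → LiesOn x y C → Adj G x y
  liesOn⇒adj C (inj₁ c) = linked-consecutive (Cycle.adjacent C) c
  liesOn⇒adj C (inj₂ c) = symm G (linked-consecutive (Cycle.adjacent C) c)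

  sameCycle-sym : ∀ {C D : Cycle G} → SameCycle C D → SameCycle D C
  sameCycle-sym e x y = mk⇔ (Equivalence.from (e x y)) (Equivalence.to (e x y))

  sameCycle-trans : ∀ {C D E : Cycle G} → SameCycle C D → SameCycle D E → SameCycle C E
  sameCycle-trans e f x y = mk⇔ (Equivalence.to (f x y) ∘ Equivalence.to (e x y))
                                (Equivalence.from (e x y) ∘ Equivalence.from (f x y))

  TwoNeighbours : Cycle G → Fin n → Set
  TwoNeighbours C z = ∃₂ λ a b → a ≢ b × LiesOn z a C × LiesOn z b C ×
                                 (∀ c → LiesOn z c C → c ≡ a ⊎ c ≡ b)

  -- The neighbours are the first and the last entry of `rest`, which differ because `rest` has at
  -- least two entries. A third is impossible since `start` does not recur in `rest`.
  start-neighbours : (C : Cycle G) → TwoNeighbours C (Cycle.start C)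
  start-neighbours record { start = s ; rest = [] ; length≥3 = s≤s () }
  start-neighbours C@(record { start = s ; rest = a ∷ r ; distinct = u ; length≥3 = 3≤ })
    with initLast r
  start-neighbours record { rest = a ∷ .[] ; length≥3 = s≤s (s≤s ()) } | []
  start-neighbours C@(record { start = s ; rest = a ∷ _ ; distinct = (s≢ ∷ (a≢ ∷ _)) }) | mid ∷ʳ′ b =
    a , b , All.lookup a≢ (∈-++⁺ʳ mid (here refl)) , inj₁ here ,
    inj₂ (consecutive-last (s ∷ a ∷ mid)) , only
    where
    s∉ : s ∉ a ∷ mid ∷ʳ b
    s∉ s∈ = All.lookup s≢ s∈ refl
    only : ∀ c → LiesOn s c C → c ≡ a ⊎ c ≡ b
    only c (inj₁ here)      = inj₁ refl
    only c (inj₁ (there k)) = contradiction (consecutive⇒∈-init (a ∷ mid ∷ʳ b) k) s∉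
    only c (inj₂ k) with consecutive-∷ʳ⁻ (s ∷ a ∷ mid) k
    ... | inj₁ k′          = contradiction (consecutive⇒∈-tail k′) s∉
    ... | inj₂ (refl , _)  = inj₂ refl

  -- Moving the base point preserves the edge set, so statements about an arbitrary vertex of a
  -- cycle reduce to its base point.
  rotate : (C : Cycle G) → ∀ {a r} → Cycle.rest C ≡ a ∷ r →
           ∃ λ (D : Cycle G) → Cycle.start D ≡ a × Cycle.rest D ≡ r ∷ʳ Cycle.start C × SameCycle C D
  rotate C@(record { start = s ; rest = a ∷ r ; distinct = s≢ ∷ u ; length≥3 = 3≤
                   ; adjacent = s~a ∷ l }) refl =
    D , refl , refl , λ x y → mk⇔ [ inj₁ ∘ to , inj₂ ∘ to ]′ [ inj₁ ∘ from , inj₂ ∘ from ]′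
    where
    D : Cycle G
    D = record
      { start    = a
      ; rest     = r ∷ʳ s
      ; distinct = unique-∷ʳ u s≢
      ; length≥3 = subst (3 ≤_) (cong suc (sym (trans (length-++ r) (+-comm (length r) 1)))) 3≤
      ; adjacent = linked-∷ʳ (a ∷ r) l s~a
      }
    to : ∀ {x y} → Consecutive x y (Cycle.closedWalk C) → Consecutive x y (Cycle.closedWalk D)
    to here      = consecutive-last (a ∷ r)
    to (there c) = consecutive-++ˡ (a ∷ []) c
    from : ∀ {x y} → Consecutive x y (Cycle.closedWalk D) → Consecutive x y (Cycle.closedWalk C)
    from c with consecutive-∷ʳ⁻ (a ∷ r) c
    ... | inj₁ c′            = there c′
    ... | inj₂ (refl , refl) = here

  -- `t` collects the vertices already passed, so that the recursion is structural in the part `r`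
  -- still ahead.
  rotateTo : ∀ r t (C : Cycle G) → Cycle.rest C ≡ r ++ t → ∀ {z} → z ∈ Cycle.start C ∷ r →
             ∃ λ (D : Cycle G) → Cycle.start D ≡ z × SameCycle C D
  rotateTo r t C e (here refl) = C , refl , λ _ _ → mk⇔ id id
  rotateTo (a ∷ r) t C e (there z∈) with rotate C e
  ... | D , refl , e′ , C≈D
    with E , eE , D≈E ← rotateTo r (t ∷ʳ Cycle.start C) D
                          (trans e′ (++-assoc r t _)) z∈
    = E , eE , sameCycle-trans {C} {D} {E} C≈D D≈E

  neighbours : (C : Cycle G) → ∀ {z} → z ∈ vertices C → TwoNeighbours C z
  neighbours C z∈
    with D , refl , C≈D ← rotateTo (Cycle.rest C) [] C (sym (++-identityʳ _)) z∈
    with a , b , a≢b , za , zb , only ← start-neighbours D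
    = a , b , a≢b , Equivalence.from (C≈D _ _) za , Equivalence.from (C≈D _ _) zb ,
      λ c zc → only c (Equivalence.to (C≈D _ _) zc)

  at-most-two : (C : Cycle G) → ∀ {z p q c} → p ≢ q →
                LiesOn z p C → LiesOn z q C → LiesOn z c C → c ≡ p ⊎ c ≡ q
  at-most-two C {p = p} {q} {c} p≢q zp zq zc
    with a , b , _ , _ , _ , only ← neighbours C (liesOn⇒∈ C zp)
    with only p zp | only q zq | only c zc
  ... | inj₁ refl | inj₁ refl | _ = contradiction refl p≢q
  ... | inj₂ refl | inj₂ refl | _ = contradiction refl p≢q
  ... | inj₁ refl | inj₂ refl | e = e
  ... | inj₂ refl | inj₁ refl | e = swap e

  other-neighbour : (C : Cycle G) → ∀ {z p} → LiesOn z p C → ∃ λ q → q ≢ p × LiesOn z q C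
  other-neighbour C {p = p} zp
    with a , b , a≢b , za , zb , only ← neighbours C (liesOn⇒∈ C zp)
    with only p zp
  ... | inj₁ refl = b , a≢b ∘ sym , zb
  ... | inj₂ refl = a , a≢b , za

  -- A cycle uses two distinct edges at each of its vertices; where the graph offers only two, it
  -- must use both.
  degree-two : (C : Cycle G) → ∀ {z a b} → z ∈ vertices C → (∀ c → Adj G z c → c ≡ a ⊎ c ≡ b) →
               LiesOn z a C × LiesOn z b C
  degree-two C z∈ only
    with p , q , p≢q , zp , zq , _ ← neighbours C z∈
    with only p (liesOn⇒adj C zp) | only q (liesOn⇒adj C zq)
  ... | inj₁ refl | inj₁ refl = contradiction refl p≢q
  ... | inj₂ refl | inj₂ refl = contradiction refl p≢q
  ... | inj₁ refl | inj₂ refl = zp , zq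
  ... | inj₂ refl | inj₁ refl = zq , zp

  -- Once the base point is rotated to `z`, following consecutive entries from there visits every
  -- vertex of the cycle.
  spread : (C : Cycle G) {S : Pred (Fin n) 0ℓ} → (∀ {x y} → LiesOn x y C → S x → S y) →
           ∀ {z} → z ∈ vertices C → S z → ∀ {x} → x ∈ vertices C → S x
  spread C {S} closed z∈ Sz x∈ with D , refl , C≈D ← rotateTo (Cycle.rest C) [] C (sym (++-identityʳ _)) z∈
    = onD (∈D x∈)
    where
    ∈D : ∀ {x} → x ∈ vertices C → x ∈ vertices D
    ∈D x∈ with a , _ , _ , xa , _ ← neighbours C x∈ = liesOn⇒∈ D (Equivalence.to (C≈D _ _) xa)
    walk : ∀ {s r} → (∀ {x y} → Consecutive x y (s ∷ r) → S x → S y) → S s → All S (s ∷ r)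
    walk {r = []}    cl Ss = Ss ∷ []
    walk {r = _ ∷ _} cl Ss = Ss ∷ walk (cl ∘ there) (cl here Ss)
    onD : ∀ {x} → x ∈ vertices D → S x
    onD = All.lookup (walk (λ k → closed (Equivalence.from (C≈D _ _) (inj₁ (consecutive-++ˡ _ k)))) Sz)

-- Bridgeless cacti have even degrees

-- The list omits the end point v.
data SimplePath {n : ℕ} (R : Rel (Fin n) 0ℓ) (v : Fin n) : Fin n → List (Fin n) → Set where
  []   : SimplePath R v v []
  step : ∀ {u w ps} → R u w → SimplePath R v w ps → u ∉ ps → u ≢ v → SimplePath R v u (u ∷ ps)

module _ {n : ℕ} {R : Rel (Fin n) 0ℓ} {v : Fin n} where

  truncate : ∀ {u ps z} → SimplePath R v u ps → z ∈ ps → ∃ (SimplePath R v z)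
  truncate p@(step _ _ _ _) (here refl) = _ , p
  truncate (step _ p _ _)   (there z∈)  = truncate p z∈

  -- If the new vertex already occurs on the erased path, the path is cut back to that occurrence;
  -- if it is `v`, the rest of the walk is discarded.
  loop-erase : ∀ {u} → Star R u v → ∃ (SimplePath R v u)
  loop-erase ε = [] , []
  loop-erase {u} (r ◅ rs) with u ≟ v | loop-erase rs
  ... | yes refl | _      = [] , []
  ... | no u≢v   | ps , p with _∈?_ _≟_ u ps
  ...   | yes u∈ = truncate p u∈
  ...   | no u∉  = u ∷ ps , step r p u∉ u≢v

  simplePath-unique : ∀ {u ps} → SimplePath R v u ps → Unique (v ∷ ps)
  simplePath-unique [] = [] ∷ []
  simplePath-unique (step _ p u∉ u≢v) with v≢ ∷ u ← simplePath-unique p =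
    (u≢v ∘ sym ∷ v≢) ∷ All.¬Any⇒All¬ _ u∉ ∷ u

  simplePath-linked : ∀ {u ps x} → SimplePath R v u ps → R x u → Linked R (x ∷ ps ∷ʳ v)
  simplePath-linked []             r = r ∷ [-]
  simplePath-linked (step s p _ _) r = r ∷ simplePath-linked p s

module _ {n : ℕ} {G : SimpleGraph n} where

  -- A simple path from `w` back to `v` that avoids the edge is closed by it. The path has at least
  -- two edges, since a single one would be the deleted edge itself.
  cycle-through : Bridgeless G → ∀ {v w} → Adj G v w → ∃ λ (C : Cycle G) → LiesOn v w C
  cycle-through bridgeless {v} {w} v~w with loop-erase (bridgeless v w v~w w v)
  ... | [] , [] = contradiction v~w (irrefl G refl)
  ... | _ , step (_ , ne) [] _ _ = contradiction (inj₂ (refl , refl)) ne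
  ... | _ , p@(step w~ p′@(step _ _ _ _) _ _) = record
    { distinct = simplePath-unique p
    ; length≥3 = s≤s (s≤s (s≤s z≤n))
    ; adjacent = v~w ∷ Linked.map proj₁ (simplePath-linked p′ w~)
    } , inj₁ here

  module _ (cactus : IsCactus G) (bridgeless : Bridgeless G) where

    cactus-degree-even : ∀ v → 2 ∣ degree G v
    cactus-degree-even v = subst (2 ∣_) (sym (degree-sum G v))
      (involution⇒even (adj? G v) partner closed fpf invol)
      where
      partner : Fin n → Fin n
      partner w with adj? G v w
      ... | yes v~w = let C , vw = cycle-through bridgeless v~w in proj₁ (other-neighbour C vw)
      ... | no _    = w
      partner-spec : ∀ w → Adj G v w →
                     ∃ λ (C : Cycle G) → LiesOn v w C × LiesOn v (partner w) C × partner w ≢ w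
      partner-spec w v~w with adj? G v w
      ... | no ¬v~w = contradiction v~w ¬v~w
      ... | yes v~w with C , vw ← cycle-through bridgeless v~w
                    with x , x≢w , vx ← other-neighbour C vw = C , vw , vx , x≢w
      closed : ∀ w → Adj G v w → Adj G v (partner w)
      closed w v~w = let C , _ , vx , _ = partner-spec w v~w in liesOn⇒adj C vx
      fpf : ∀ w → Adj G v w → partner w ≢ w
      fpf w v~w = let _ , _ , _ , ne = partner-spec w v~w in ne
      -- The cycle `D` chosen for the edge to `partner w` need not be the cycle `C` chosen for the
      -- edge to `w`. Both contain the edge to `partner w`, so they have the same edges, and the two
      -- edges of `D` at `v` leave only one place for `w`.
      invol : ∀ w → Adj G v w → partner (partner w) ≡ w
      invol w v~w
        with C , vw , vx , x≢w ← partner-spec w v~w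
        with D , vx′ , vy , y≢x ← partner-spec (partner w) (closed w v~w)
        with at-most-two D (y≢x ∘ sym) vx′ vy (Equivalence.to
               (IsCactus.at-most-one-cycle cactus v (partner w) (closed w v~w) C D vx vx′ v w) vw)
      ... | inj₁ w≡x = contradiction (sym w≡x) x≢w
      ... | inj₂ w≡y = sym w≡y

  degree-total : sum (degree G) ≡ sum (λ v → sum λ w → 𝟙 (adj? G v w))
  degree-total = sum-cong-≗ (degree-sum G)

  bipartite-edges-even : Bipartite G → (∀ v → 2 ∣ degree G v) →
                         ∃ λ m → sum (degree G) ≡ 2 * m × 2 ∣ m
  bipartite-edges-even (colour , proper) even = _ ,
    trans degree-total (sum-orientation (adj? G) O? split (λ _ _ → proj₁)
      (λ v w → symm G ∘ proj₁)
      (λ v w (v~w , cv) (_ , cw) → proper v w v~w (trans cv (sym cw)))) ,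
    ∣-sum 2 row
    where
    O : Rel (Fin n) 0ℓ
    O v w = Adj G v w × colour v ≡ true
    O? : Decidable O
    O? v w = adj? G v w ×-dec colour v Bool.≟ true
    split : ∀ v w → Adj G v w → O v w ⊎ O w v
    split v w v~w with colour v in cv | colour w in cw
    ... | true  | _     = inj₁ (v~w , refl)
    ... | false | true  = inj₂ (symm G v~w , refl)
    ... | false | false = contradiction (trans cv (sym cw)) (proper v w v~w)
    row : ∀ v → 2 ∣ sum (λ w → 𝟙 (O? v w))
    row v with colour v Bool.≟ true
    ... | yes c = subst (2 ∣_) (trans (degree-sum G v) (sum-cong-≗ λ w →
                    𝟙-cong (adj? G v w) (adj? G v w ×-dec yes c) (_, c) proj₁)) (even v)
    ... | no ¬c = subst (2 ∣_) (sym (sum-zero _ λ w →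
                    𝟙-false (adj? G v w ×-dec no ¬c) (¬c ∘ proj₂))) (2 ∣0)

-- Breadth-first levels and the edge bound

least : {P : ℕ → Set} → (∀ k → Dec (P k)) → ∀ k → P k →
        ∃ λ m → P m × (∀ {j} → P j → m ≤ j)
least P? zero    p = 0 , p , λ _ → z≤n
least P? (suc k) p with P? 0
... | yes p₀ = 0 , p₀ , λ _ → z≤n
... | no ¬p₀ with m , q , min ← least (P? ∘ suc) k p =
  suc m , q , λ { {zero} p₀ → contradiction p₀ ¬p₀ ; {suc j} pj → s≤s (min pj) }

module BreadthFirst {n : ℕ} (G : SimpleGraph n) (connected : Connected G)
                    (bipartite : Bipartite G) (r : Fin n) where

  private
    colour : Fin n → Bool
    colour = proj₁ bipartite

  -- Walks of length exactly `k`. In a bipartite graph the exact length determines the colour of the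
  -- end point, while the least such length is the distance from `r`.
  Reach : ℕ → Fin n → Set
  Reach zero    v = v ≡ r
  Reach (suc k) v = ∃ λ u → Reach k u × Adj G u v

  reach? : ∀ v k → Dec (Reach k v)
  reach? v zero    = v ≟ r
  reach? v (suc k) = any? λ u → reach? u k ×-dec adj? G u v

  star⇒reach : ∀ {u v k} → Star (Adj G) u v → Reach k u → ∃ λ j → Reach j v
  star⇒reach ε        p = _ , p
  star⇒reach (a ◅ as) p = star⇒reach as (_ , p , a)

  private
    shortest : ∀ v → ∃ λ m → Reach m v × (∀ {j} → Reach j v → m ≤ j)
    shortest v = let k , p = star⇒reach {k = 0} (connected r v) refl in least (reach? v) k p

  level : Fin n → ℕ
  level v = proj₁ (shortest v)

  level-reach : ∀ v → Reach (level v) v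
  level-reach v = proj₁ (proj₂ (shortest v))

  level-min : ∀ {v k} → Reach k v → level v ≤ k
  level-min {v} = proj₂ (proj₂ (shortest v))

  level-zero : ∀ {v} → level v ≡ 0 → v ≡ r
  level-zero {v} e = subst (λ k → Reach k v) e (level-reach v)

  level-root : level r ≡ 0
  level-root = n≤0⇒n≡0 (level-min refl)

  level-step : ∀ {u v} → Adj G u v → level v ≤ suc (level u)
  level-step {u} a = level-min (u , level-reach u , a)

  reach-colour : ∀ {j k v w} → Reach k v → Reach j w → j ≡ k → colour v ≡ colour w
  reach-colour {k = zero}  refl refl refl = refl
  reach-colour {k = suc k} (u , p , u~v) (x , q , x~w) refl = begin
    colour _       ≡⟨ ¬-not (proj₂ bipartite _ _ u~v ∘ sym) ⟩
    not (colour u) ≡⟨ cong not (reach-colour p q refl) ⟩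
    not (colour x) ≡⟨ ¬-not (proj₂ bipartite _ _ x~w ∘ sym) ⟨
    colour _       ∎
    where open ≡-Reasoning

  -- Adjacent levels differ by at most one. They cannot agree, because equal distance from `r`
  -- forces equal colour.
  edge-levels : ∀ {u v} → Adj G u v → level u ≡ suc (level v) ⊎ level v ≡ suc (level u)
  edge-levels {u} {v} a with <-cmp (level u) (level v)
  ... | tri< lt _ _ = inj₂ (≤-antisym (level-step a) lt)
  ... | tri> _ _ gt = inj₁ (≤-antisym (level-step (symm G a)) gt)
  ... | tri≈ _ e _  = contradiction (reach-colour (level-reach u) (level-reach v) (sym e))
                                    (proj₂ bipartite u v a)

  Up : Rel (Fin n) 0ℓ
  Up v w = Adj G v w × level v ≡ suc (level w)

  up? : Decidable Up
  up? v w = adj? G v w ×-dec level v ℕ.≟ suc (level w)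

  up⇒≢root : ∀ {v w} → Up v w → v ≢ r
  up⇒≢root (_ , e) refl = contradiction (trans (sym level-root) e) λ ()

  -- The penultimate vertex of a shortest walk from `r` to `v` lies exactly one level closer to `r`.
  up-exists : ∀ v → v ≢ r → ∃ (Up v)
  up-exists v v≢r = go (level v) (level-reach v) refl
    where
    go : ∀ k → Reach k v → level v ≡ k → ∃ (Up v)
    go zero    p             e = contradiction p v≢r
    go (suc k) (u , p , u~v) e = u , symm G u~v ,
      ≤-antisym (level-step u~v) (subst (suc (level u) ≤_) (sym e) (s≤s (level-min p)))

  parent : Fin n → Fin n
  parent v with v ≟ r
  ... | yes _  = r
  ... | no v≢r = proj₁ (up-exists v v≢r)

  parent-up : ∀ {v} → v ≢ r → Up v (parent v)
  parent-up {v} v≢r with v ≟ r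
  ... | yes v≡r = contradiction v≡r v≢r
  ... | no v≢r  = proj₂ (up-exists v v≢r)

  up-level< : ∀ {v w} → Up v w → level w < level v
  up-level< (_ , e) = ≤-reflexive (sym e)

  level-suc⇒≢root : ∀ {v k} → level v ≡ suc k → v ≢ r
  level-suc⇒≢root e refl = contradiction (trans (sym level-root) e) λ ()

  -- The climb from a and b, level by level, to their first common ancestor.
  tree-path : ∀ k {a b} → level a ≡ k → level b ≡ k → a ≢ b →
    ∃ λ mid → Linked (Adj G) (a ∷ mid ∷ʳ b) × Unique (a ∷ mid ∷ʳ b) × All (λ x → level x < k) mid ×
              Consecutive a (parent a) (a ∷ mid ∷ʳ b) × Consecutive (parent b) b (a ∷ mid ∷ʳ b)
  tree-path zero    ea eb a≢b = contradiction (trans (level-zero ea) (sym (level-zero eb))) a≢b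
  tree-path (suc k) {a} {b} ea eb a≢b
    with ua ← parent-up (level-suc⇒≢root ea) | ub ← parent-up (level-suc⇒≢root eb)
    with parent a ≟ parent b
  ... | yes p≡ = parent a ∷ [] ,
        proj₁ ua ∷ subst (λ p → Adj G p b) (sym p≡) (symm G (proj₁ ub)) ∷ [-] ,
        (a≢pa ∷ a≢b ∷ []) ∷ ((λ e → b≢pb (trans (sym e) p≡)) ∷ []) ∷ [] ∷ [] ,
        subst (level (parent a) <_) ea (up-level< ua) ∷ [] ,
        here , subst (λ p → Consecutive p b (a ∷ parent a ∷ b ∷ [])) p≡ (there here)
    where
    a≢pa : a ≢ parent a
    a≢pa e = <-irrefl (cong level (sym e)) (up-level< ua)
    b≢pb : b ≢ parent b
    b≢pb e = <-irrefl (cong level (sym e)) (up-level< ub)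
  ... | no p≢
    with mid , lnk , unq , low , _ ← tree-path k (suc-injective (trans (sym (proj₂ ua)) ea))
                                                 (suc-injective (trans (sym (proj₂ ub)) eb)) p≢
    -- All vertices strictly between lie at smaller levels than `a` and `b`, so neither end can
    -- recur on the path.
    = L , proj₁ ua ∷ linked-∷ʳ (parent a ∷ mid) lnk (symm G (proj₁ ub)) ,
      All.++⁺ (All.map (avoid ea) low′) (a≢b ∷ []) ∷ unique-∷ʳ unq (All.map (avoid eb) low′) ,
      low′ , here , consecutive-last (a ∷ parent a ∷ mid)
    where
    L = parent a ∷ mid ∷ʳ parent b
    low′ : All (λ x → level x < suc k) L
    low′ = subst (level (parent a) <_) ea (up-level< ua) ∷
           All.++⁺ (All.map m<n⇒m<1+n low) (subst (level (parent b) <_) eb (up-level< ub) ∷ [])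
    avoid : ∀ {c x} → level c ≡ suc k → level x < suc k → c ≢ x
    avoid e lt refl = <-irrefl e lt

  NonTree : Rel (Fin n) 0ℓ
  NonTree v w = Up v w × w ≢ parent v

  nonTree? : Decidable NonTree
  nonTree? v w = up? v w ×-dec ¬? (w ≟ parent v)

  -- A tree edge is represented by its end farther from the root. These three vertices thus stand
  -- for the three tree edges charged to the pair `(v , w)`.
  Near : Fin n → Fin n → Fin n → Set
  Near v w x = x ≡ v ⊎ x ≡ parent v ⊎ x ≡ w

  near? : ∀ v w x → Dec (Near v w x)
  near? v w x = x ≟ v ⊎-dec x ≟ parent v ⊎-dec x ≟ w

  module _ {v w : Fin n} (nt : NonTree v w) where

    private
      up = proj₁ nt
      pup = parent-up (up⇒≢root up)
      w≢pv = proj₂ nt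

      same-level : level w ≡ level (parent v)
      same-level = suc-injective (trans (sym (proj₂ up)) (proj₂ pup))

    -- If `parent v` or `w` were the root, their common level would be zero and both would be the
    -- root, although they are distinct.
    near⇒≢root : ∀ {x} → Near v w x → x ≢ r
    near⇒≢root (inj₁ refl) = up⇒≢root up
    near⇒≢root (inj₂ (inj₁ refl)) pv≡r =
      w≢pv (trans (level-zero (trans same-level (trans (cong level pv≡r) level-root))) (sym pv≡r))
    near⇒≢root (inj₂ (inj₂ refl)) refl = w≢pv (sym (level-zero (trans (sym same-level) level-root)))

    -- The tree path joining `parent v` and `w`, which share a level, is closed through `v`. All its
    -- vertices have smaller level than `v`, and this is what later recovers `v` from the edge set
    -- alone.
    fundamental-cycle : ∃ λ (C : Cycle G) → LiesOn v w C × LiesOn v (parent v) C ×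
      (∀ {x} → x ∈ vertices C → x ≡ v ⊎ level x < level v) ×
      (∀ {x} → Near v w x → LiesOn x (parent x) C)
    fundamental-cycle
      with mid , lnk , unq , low , pp , pw ← tree-path (level (parent v)) refl same-level (w≢pv ∘ sym)
      = C , inj₂ (consecutive-last (v ∷ parent v ∷ mid)) , inj₁ here , deep , on
      where
      low′ : All (λ x → level x < level v) (parent v ∷ mid ∷ʳ w)
      low′ = up-level< pup ∷
             All.++⁺ (All.map (λ lt → <-trans lt (up-level< pup)) low) (up-level< up ∷ [])
      C : Cycle G
      C = record
        { start    = v
        ; rest     = parent v ∷ mid ∷ʳ w
        ; distinct = All.map (λ lt e → <-irrefl (cong level (sym e)) lt) low′ ∷ unq
        ; length≥3 = s≤s (s≤s (subst (1 ≤_) (sym (trans (length-++ mid) (+-comm (length mid) 1)))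
                                            (s≤s z≤n)))
        ; adjacent = proj₁ pup ∷ linked-∷ʳ (parent v ∷ mid) lnk (symm G (proj₁ up))
        }
      deep : ∀ {x} → x ∈ vertices C → x ≡ v ⊎ level x < level v
      deep (here e)   = inj₁ e
      deep (there x∈) = inj₂ (All.lookup low′ x∈)
      on : ∀ {x} → Near v w x → LiesOn x (parent x) C
      on (inj₁ refl)        = inj₁ here
      on (inj₂ (inj₁ refl)) = inj₁ (there (consecutive-++ˡ _ pp))
      on (inj₂ (inj₂ refl)) = inj₂ (there (consecutive-++ˡ _ pw))

    near-count : sum (λ x → 𝟙 (near? v w x)) ≡ 3
    near-count = begin
      sum (λ x → 𝟙 (near? v w x))
        ≡⟨ sum-cong-≗ (λ x → trans
             (𝟙-⊎ (near? v w x) (x ≟ v) (x ≟ parent v ⊎-dec x ≟ w) id inj₁ inj₂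
                  λ { refl → [ v≢pv , v≢w ]′ })
             (cong (𝟙 (x ≟ v) +_) (𝟙-⊎ (x ≟ parent v ⊎-dec x ≟ w) (x ≟ parent v) (x ≟ w) id inj₁ inj₂
                  λ { refl → w≢pv ∘ sym }))) ⟩
      sum (λ x → 𝟙 (x ≟ v) + (𝟙 (x ≟ parent v) + 𝟙 (x ≟ w)))
        ≡⟨ ∑-distrib-+ (λ x → 𝟙 (x ≟ v)) _ ⟩
      sum (λ x → 𝟙 (x ≟ v)) + sum (λ x → 𝟙 (x ≟ parent v) + 𝟙 (x ≟ w))
        ≡⟨ cong₂ _+_ (sum-𝟙-≡ v) (trans (∑-distrib-+ (λ x → 𝟙 (x ≟ parent v)) _)
             (cong₂ _+_ (sum-𝟙-≡ (parent v)) (sum-𝟙-≡ w))) ⟩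
      3 ∎
      where
      open ≡-Reasoning
      v≢pv : v ≢ parent v
      v≢pv e = <-irrefl (cong level (sym e)) (up-level< pup)
      v≢w : v ≢ w
      v≢w e = <-irrefl (cong level (sym e)) (up-level< up)

  edge-count : sum (degree G) ≡ 2 * sum (λ v → sum λ w → 𝟙 (up? v w))
  edge-count = trans (degree-total {G = G}) (sum-orientation (adj? G) up? split (λ _ _ → proj₁)
    (λ _ _ → symm G ∘ proj₁) (λ _ _ a b → <-asym (up-level< a) (up-level< b)))
    where
    split : ∀ v w → Adj G v w → Up v w ⊎ Up w v
    split v w a with edge-levels a
    ... | inj₁ e = inj₁ (a , e)
    ... | inj₂ e = inj₂ (symm G a , e)

  private
    nonRoots nonTrees : ℕ
    nonRoots = sum (λ v → 𝟙 (¬? (v ≟ r)))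
    nonTrees = sum (λ v → sum λ w → 𝟙 (nonTree? v w))

  suc-nonRoots : suc nonRoots ≡ n
  suc-nonRoots = begin
    suc nonRoots
      ≡⟨ cong (_+ nonRoots) (sum-𝟙-≡ r) ⟨
    sum (λ v → 𝟙 (v ≟ r)) + nonRoots
      ≡⟨ ∑-distrib-+ (λ v → 𝟙 (v ≟ r)) _ ⟨
    sum (λ v → 𝟙 (v ≟ r) + 𝟙 (¬? (v ≟ r)))
      ≡⟨ sum-cong-≗ one ⟩
    sum {n} (λ _ → 1)
      ≡⟨ trans (sum-const n 1) (*-identityʳ n) ⟩
    n ∎
    where
    open ≡-Reasoning
    one : ∀ v → 𝟙 (v ≟ r) + 𝟙 (¬? (v ≟ r)) ≡ 1
    one v with v ≟ r
    ... | yes _ = refl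
    ... | no _  = refl

  up-count : sum (λ v → sum λ w → 𝟙 (up? v w)) ≡ nonRoots + nonTrees
  up-count = trans (sum-cong-≗ row) (∑-distrib-+ (λ v → 𝟙 (¬? (v ≟ r))) _)
    where
    row : ∀ v → sum (λ w → 𝟙 (up? v w)) ≡ 𝟙 (¬? (v ≟ r)) + sum (λ w → 𝟙 (nonTree? v w))
    row v = helper (v ≟ r)
     where
     open ≡-Reasoning
     split : ∀ w → Up v w → w ≡ parent v ⊎ NonTree v w
     split w u with w ≟ parent v
     ... | yes e = inj₁ e
     ... | no ne = inj₂ (u , ne)
     helper : (d : Dec (v ≡ r)) →
              sum (λ w → 𝟙 (up? v w)) ≡ 𝟙 (¬? d) + sum (λ w → 𝟙 (nonTree? v w))
     helper (yes v≡r) = trans (sum-zero _ λ w → 𝟙-false (up? v w) λ u → up⇒≢root u v≡r)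
       (sym (sum-zero _ λ w → 𝟙-false (nonTree? v w) λ u → up⇒≢root (proj₁ u) v≡r))
     helper (no v≢r) = begin
      sum (λ w → 𝟙 (up? v w))
        ≡⟨ sum-cong-≗ (λ w → 𝟙-⊎ (up? v w) (w ≟ parent v) (nonTree? v w) (split w)
             (λ { refl → parent-up v≢r }) proj₁ (λ e nt → proj₂ nt e)) ⟩
      sum (λ w → 𝟙 (w ≟ parent v) + 𝟙 (nonTree? v w))
        ≡⟨ ∑-distrib-+ (λ w → 𝟙 (w ≟ parent v)) _ ⟩
      sum (λ w → 𝟙 (w ≟ parent v)) + sum (λ w → 𝟙 (nonTree? v w))
        ≡⟨ cong (_+ sum (λ w → 𝟙 (nonTree? v w))) (sum-𝟙-≡ (parent v)) ⟩
      1 + sum (λ w → 𝟙 (nonTree? v w)) ∎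

  module _ (cactus : IsCactus G) where

    -- Two fundamental cycles sharing a tree edge coincide, and v is the
    -- unique deepest vertex of its cycle.
    near-unique : ∀ {v w v′ w′ x} → NonTree v w → NonTree v′ w′ →
                  Near v w x → Near v′ w′ x → v ≡ v′ × w ≡ w′
    near-unique {v} {w} {v′} {w′} {x} nt nt′ near near′
      with C , vw , vp , deep , on ← fundamental-cycle nt
      with D , vw′ , vp′ , deep′ , on′ ← fundamental-cycle nt′
      = v≡v′ , w≡w′ v≡v′
      where
      C≈D : SameCycle C D
      C≈D = IsCactus.at-most-one-cycle cactus x (parent x) (liesOn⇒adj C (on near)) C D
              (on near) (on′ near′)
      v≡v′ : v ≡ v′
      v≡v′ with deep (liesOn⇒∈ C (Equivalence.from (C≈D _ _) vw′))
              | deep′ (liesOn⇒∈ D (Equivalence.to (C≈D _ _) vw))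
      ... | inj₁ e  | _       = sym e
      ... | inj₂ _  | inj₁ e  = e
      ... | inj₂ lt | inj₂ gt = contradiction gt (<-asym lt)
      w≡w′ : v ≡ v′ → w ≡ w′
      w≡w′ refl with at-most-two C (proj₂ nt) vw vp (Equivalence.from (C≈D _ _) vw′)
      ... | inj₁ e = sym e
      ... | inj₂ e = contradiction e (proj₂ nt′)

    -- Double counting of the incidences between non-tree pairs and vertices near them: every pair
    -- has three, every non-root vertex belongs to at most one pair by `near-unique`, and the root
    -- belongs to none.
    3*nonTrees≤nonRoots : 3 * nonTrees ≤ nonRoots
    3*nonTrees≤nonRoots = begin
      3 * nonTrees
        ≡⟨ trans (*-distribˡ-sum 3 (λ v → sum λ w → 𝟙 (nonTree? v w)))
             (sum-cong-≗ λ v → trans (*-distribˡ-sum 3 (λ w → 𝟙 (nonTree? v w))) (sum-cong-≗ (triple v))) ⟩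
      sum (λ v → sum λ w → sum λ x → 𝟙 (Q? x v w))
        ≡⟨ sum-cong-≗ (λ v → ∑-comm (λ w x → 𝟙 (Q? x v w))) ⟩
      sum (λ v → sum λ x → sum λ w → 𝟙 (Q? x v w))
        ≡⟨ ∑-comm (λ v x → sum λ w → 𝟙 (Q? x v w)) ⟩
      sum (λ x → sum λ v → sum λ w → 𝟙 (Q? x v w))
        ≤⟨ sum-mono bound ⟩
      nonRoots ∎
      where
      open ≤-Reasoning
      Q : Fin n → Fin n → Fin n → Set
      Q x v w = NonTree v w × Near v w x
      Q? : ∀ x v w → Dec (Q x v w)
      Q? x v w = nonTree? v w ×-dec near? v w x
      triple : ∀ v w → 3 * 𝟙 (nonTree? v w) ≡ sum (λ x → 𝟙 (Q? x v w))
      triple v w = helper (nonTree? v w)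
        where
        helper : (d : Dec (NonTree v w)) → 3 * 𝟙 d ≡ sum (λ x → 𝟙 (d ×-dec near? v w x))
        helper (yes nt) = sym (trans (sum-cong-≗ λ x →
          𝟙-cong (yes nt ×-dec near? v w x) (near? v w x) proj₂ (nt ,_)) (near-count nt))
        helper (no ¬nt) = sym (sum-zero _ λ x → 𝟙-false (no ¬nt ×-dec near? v w x) (¬nt ∘ proj₁))
      bound : ∀ x → sum (λ v → sum λ w → 𝟙 (Q? x v w)) ≤ 𝟙 (¬? (x ≟ r))
      bound x with any? (λ v → any? λ w → Q? x v w)
      ... | no none = ≤-trans (≤-reflexive (sum-zero _ λ v → sum-zero _ λ w →
              𝟙-false (Q? x v w) λ q → none (v , w , q))) z≤n
      -- The pair found is the only one near `x`, so the double sum is exactly 1, and `x` is not the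
      -- root.
      ... | yes (v₀ , w₀ , nt₀ , near₀) = ≤-reflexive (trans (trans (sum-cong-≗ row) (sum-𝟙-≡ v₀))
              (sym (𝟙-true (¬? (x ≟ r)) (near⇒≢root nt₀ near₀))))
        where
        row : ∀ v → sum (λ w → 𝟙 (Q? x v w)) ≡ 𝟙 (v ≟ v₀)
        row v with v ≟ v₀
        ... | yes refl = sum-𝟙-unique (Q? x v) w₀ (nt₀ , near₀)
                           (λ w (nt , near) → proj₂ (near-unique nt nt₀ near near₀))
        ... | no v≢v₀ = sum-zero _ λ w → 𝟙-false (Q? x v w)
                           (λ (nt , near) → v≢v₀ (proj₁ (near-unique nt nt₀ near near₀)))

    -- With m = (n - 1) + t and 3t ≤ n - 1 this is 3m ≤ 4(n - 1), put additively to avoid truncated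
    -- subtraction.
    cactus-edge-bound : ∃ λ m → sum (degree G) ≡ 2 * m × 3 * m + 4 ≤ 4 * n
    cactus-edge-bound = nonRoots + nonTrees , trans edge-count (cong (2 *_) up-count) , (begin
      3 * (nonRoots + nonTrees) + 4       ≡⟨ solve₁ nonRoots nonTrees ⟩
      3 * nonTrees + (3 * nonRoots + 4)   ≤⟨ +-monoˡ-≤ _ 3*nonTrees≤nonRoots ⟩
      nonRoots + (3 * nonRoots + 4)       ≡⟨ solve₂ nonRoots ⟩
      4 * suc nonRoots                    ≡⟨ cong (4 *_) suc-nonRoots ⟩
      4 * n                               ∎)
      where
      open ≤-Reasoning
      solve₁ : ∀ s t → 3 * (s + t) + 4 ≡ 3 * t + (3 * s + 4)
      solve₁ = solve-∀
      solve₂ : ∀ s → s + (3 * s + 4) ≡ 4 * suc s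
      solve₂ = solve-∀

-- Cycles inside an embedded subgraph

module _ {A B : Set} {f : A → B} where

  consecutive-map⁺ : ∀ {x y xs} → Consecutive x y xs → Consecutive (f x) (f y) (map f xs)
  consecutive-map⁺ here      = here
  consecutive-map⁺ (there c) = there (consecutive-map⁺ c)

  consecutive-map⁻ : ∀ {a b} xs → Consecutive a b (map f xs) →
                     ∃₂ λ x y → f x ≡ a × f y ≡ b × Consecutive x y xs
  consecutive-map⁻ []           ()
  consecutive-map⁻ (x ∷ [])     (there ())
  consecutive-map⁻ (x ∷ y ∷ xs) here = x , y , refl , refl , here
  consecutive-map⁻ (x ∷ y ∷ xs) (there c)
    with x′ , y′ , e , e′ , c′ ← consecutive-map⁻ (y ∷ xs) c = x′ , y′ , e , e′ , there c′

  map-preimage : ∀ {xs} → All (λ b → ∃ λ a → f a ≡ b) xs → ∃ λ ys → map f ys ≡ xs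
  map-preimage []               = [] , refl
  map-preimage ((a , refl) ∷ p) with ys , refl ← map-preimage p = a ∷ ys , refl

module _ {n n′ : ℕ} {G : SimpleGraph n} {G′ : SimpleGraph n′} (f : Fin n → Fin n′)
         (f-injective : Injective _≡_ _≡_ f)
         (reflects : ∀ {x y} → Adj G′ (f x) (f y) → Adj G x y) where

  InImage : Cycle G′ → Set
  InImage C = All (λ z → ∃ λ x → f x ≡ z) (vertices C)

  restrict : (C′ : Cycle G′) → InImage C′ →
             ∃ λ (C : Cycle G) → map f (Cycle.closedWalk C) ≡ Cycle.closedWalk C′
  restrict record { start = _ ; rest = _ ; distinct = u ; length≥3 = l ; adjacent = k } ((s , refl) ∷ img)
    with r , refl ← map-preimage img
    = record
      { start    = s
      ; rest     = r
      ; distinct = Unique.map⁻ u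
      ; length≥3 = subst (3 ≤_) (cong suc (length-map f r)) l
      ; adjacent = Linked.map reflects (Linked.map⁻ (subst (Linked (Adj G′)) (sym walk) k))
      } , walk
    where
    walk : map f (s ∷ r ∷ʳ s) ≡ f s ∷ map f r ∷ʳ f s
    walk = cong (f s ∷_) (map-++ f r (s ∷ []))

  module _ {C : Cycle G} {C′ : Cycle G′} (walk : map f (Cycle.closedWalk C) ≡ Cycle.closedWalk C′) where

    liesOn-map⁺ : ∀ {x y} → LiesOn x y C → LiesOn (f x) (f y) C′
    liesOn-map⁺ (inj₁ c) = inj₁ (subst (Consecutive _ _) walk (consecutive-map⁺ c))
    liesOn-map⁺ (inj₂ c) = inj₂ (subst (Consecutive _ _) walk (consecutive-map⁺ c))

    liesOn-map⁻ : ∀ {a b} → LiesOn a b C′ → ∃₂ λ x y → f x ≡ a × f y ≡ b × LiesOn x y C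
    liesOn-map⁻ (inj₁ c) with x , y , e , e′ , c′ ← consecutive-map⁻ (Cycle.closedWalk C)
                                                      (subst (Consecutive _ _) (sym walk) c)
      = x , y , e , e′ , inj₁ c′
    liesOn-map⁻ (inj₂ c) with y , x , e , e′ , c′ ← consecutive-map⁻ (Cycle.closedWalk C)
                                                      (subst (Consecutive _ _) (sym walk) c)
      = x , y , e′ , e , inj₂ c′

  -- Cycles inside the image pull back to `G`, and injectivity makes their common edge pull back to
  -- one common edge. This serves both the old part of an attached graph and the relabelling by
  -- `opposite`.
  at-most-one-cycle-in-image : IsCactus G → ∀ {u v} (C D : Cycle G′) → InImage C → InImage D →
                               LiesOn u v C → LiesOn u v D → SameCycle C D
  at-most-one-cycle-in-image cactus C D imC imD uvC uvD
    with C₀ , walkC ← restrict C imC | D₀ , walkD ← restrict D imD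
    with x , y , refl , refl , xyC ← liesOn-map⁻ {C₀} {C} walkC uvC
       | x′ , y′ , ex , ey , xyD ← liesOn-map⁻ {D₀} {D} walkD uvD
    with refl ← f-injective ex | refl ← f-injective ey
    = λ a b → mk⇔ (transfer {C₀} {D₀} {C} {D} walkC walkD C₀≈D₀)
                  (transfer {D₀} {C₀} {D} {C} walkD walkC (sameCycle-sym {C = C₀} {D₀} C₀≈D₀))
    where
    C₀≈D₀ : SameCycle C₀ D₀
    C₀≈D₀ = IsCactus.at-most-one-cycle cactus x y (liesOn⇒adj C₀ xyC) C₀ D₀ xyC xyD
    transfer : ∀ {A B : Cycle G} {A′ B′ : Cycle G′} →
               map f (Cycle.closedWalk A) ≡ Cycle.closedWalk A′ →
               map f (Cycle.closedWalk B) ≡ Cycle.closedWalk B′ →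
               SameCycle A B → ∀ {a b} → LiesOn a b A′ → LiesOn a b B′
    transfer {A} {B} {A′} {B′} wA wB A≈B ab
      with x , y , refl , refl , xy ← liesOn-map⁻ {A} {A′} wA ab
      = liesOn-map⁺ {B} {B′} wB (Equivalence.to (A≈B x y) xy)

-- Bridgelessness from detours

module _ {n : ℕ} (G : SimpleGraph n) where

  Detour : Fin n → Fin n → Set
  Detour u v = Star (Adj (deleteEdge G u v)) u v

  detour-sym : ∀ {u v} → Detour u v → Detour v u
  detour-sym = Star.reverse λ (a , ne) → symm G a ,
    λ { (inj₁ (e , e′)) → ne (inj₁ (e′ , e)) ; (inj₂ (e , e′)) → ne (inj₂ (e′ , e)) }

  -- Any walk survives the deletion of an edge once each passage over that edge is replaced by the
  -- detour.
  detours⇒bridgeless : Connected G → (∀ u v → Adj G u v → Detour u v) → Bridgeless G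
  detours⇒bridgeless connected detour u v u~v x y = connected x y Star.>>= replace
    where
    replace : ∀ {x y} → Adj G x y → Star (Adj (deleteEdge G u v)) x y
    replace {x} {y} a with sameEdge? u v x y
    ... | yes (inj₁ (refl , refl)) = detour u v u~v
    ... | yes (inj₂ (refl , refl)) = Star.reverse (symm (deleteEdge G u v)) (detour u v u~v)
    ... | no ne                    = (a , ne) ◅ ε

  keep : ∀ {u v x y} → Adj G x y → {False (sameEdge? u v x y)} → Adj (deleteEdge G u v) x y
  keep a {ne} = a , toWitnessFalse ne

-- Attaching a 4-cycle at a vertex

pattern old x = suc (suc (suc x))

module Attach {n : ℕ} (G : SimpleGraph n) (h : Fin n) where

  private
    -- The added cycle runs through `old h`, `0F`, `1F`, `2F` in this order. Four is the least
    -- length of a cycle in a bipartite graph, so one unit of excess costs three new vertices.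
    A : Rel (Fin (3 + n)) 0ℓ
    A 0F      1F      = ⊤
    A 0F      (old y) = y ≡ h
    A 1F      0F      = ⊤
    A 1F      2F      = ⊤
    A 2F      1F      = ⊤
    A 2F      (old y) = y ≡ h
    A (old x) 0F      = x ≡ h
    A (old x) 2F      = x ≡ h
    A (old x) (old y) = Adj G x y
    A _       _       = ⊥

    A? : Decidable A
    A? 0F      0F      = no λ ()
    A? 0F      1F      = yes tt
    A? 0F      2F      = no λ ()
    A? 0F      (old y) = y ≟ h
    A? 1F      0F      = yes tt
    A? 1F      1F      = no λ ()
    A? 1F      2F      = yes tt
    A? 1F      (old y) = no λ ()
    A? 2F      0F      = no λ ()
    A? 2F      1F      = yes tt
    A? 2F      2F      = no λ ()
    A? 2F      (old y) = y ≟ h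
    A? (old x) 0F      = x ≟ h
    A? (old x) 1F      = no λ ()
    A? (old x) 2F      = x ≟ h
    A? (old x) (old y) = adj? G x y

    A-sym : ∀ x y → A x y → A y x
    A-sym 0F      1F      a = a
    A-sym 0F      (old y) a = a
    A-sym 1F      0F      a = a
    A-sym 1F      2F      a = a
    A-sym 2F      1F      a = a
    A-sym 2F      (old y) a = a
    A-sym (old x) 0F      a = a
    A-sym (old x) 2F      a = a
    A-sym (old x) (old y) a = symm G a

    A-irrefl : ∀ x → ¬ A x x
    A-irrefl (old x) a = irrefl G refl a

  attach : SimpleGraph (3 + n)
  attach = record
    { Adj    = A
    ; adj?   = A?
    ; symm   = λ {x} {y} → A-sym x y
    ; irrefl = λ { {x} refl → A-irrefl x }
    }

  attach-degree-old : ∀ x → degree attach (old x) ≡ 2 * 𝟙 (x ≟ h) + degree G x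
  attach-degree-old x = begin
    degree attach (old x)
      ≡⟨ degree-sum attach (old x) ⟩
    𝟙 (x ≟ h) + (𝟙 (x ≟ h) + sum (λ y → 𝟙 (adj? G x y)))
      ≡⟨ +-assoc (𝟙 (x ≟ h)) _ _ ⟨
    𝟙 (x ≟ h) + 𝟙 (x ≟ h) + sum (λ y → 𝟙 (adj? G x y))
      ≡⟨ cong₂ _+_ (cong (𝟙 (x ≟ h) +_) (sym (+-identityʳ (𝟙 (x ≟ h))))) (sym (degree-sum G x)) ⟩
    2 * 𝟙 (x ≟ h) + degree G x ∎
    where open ≡-Reasoning

  attach-degree-0 : degree attach 0F ≡ 2
  attach-degree-0 = trans (degree-sum attach 0F) (cong suc (sum-𝟙-≡ h))

  attach-degree-1 : degree attach 1F ≡ 2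
  attach-degree-1 = trans (degree-sum attach 1F) (cong (2 +_) (sum-zero {n} (λ _ → 0) (λ _ → refl)))

  attach-degree-2 : degree attach 2F ≡ 2
  attach-degree-2 = trans (degree-sum attach 2F) (cong suc (sum-𝟙-≡ h))

  attach-connected : Connected G → Connected attach
  attach-connected connected u v = to-h u ◅◅ Star.reverse (λ {x} {y} → A-sym x y) (to-h v)
    where
    to-h : ∀ x → Star A x (old h)
    to-h 0F      = refl ◅ ε
    to-h 1F      = tt ◅ to-h 0F
    to-h 2F      = refl ◅ ε
    to-h (old x) = gmap (λ y → old y) id (connected x h)

  attach-bipartite : Bipartite G → Bipartite attach
  attach-bipartite (colour , proper) = colour′ , proper′
    where
    colour′ : Fin (3 + n) → Bool
    colour′ 0F      = not (colour h)
    colour′ 1F      = colour h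
    colour′ 2F      = not (colour h)
    colour′ (old x) = colour x
    proper′ : ∀ u v → A u v → colour′ u ≢ colour′ v
    proper′ 0F      1F      _    = not-¬ refl ∘ sym
    proper′ 0F      (old _) refl = not-¬ refl ∘ sym
    proper′ 1F      0F      _    = not-¬ refl
    proper′ 1F      2F      _    = not-¬ refl
    proper′ 2F      1F      _    = not-¬ refl ∘ sym
    proper′ 2F      (old _) refl = not-¬ refl ∘ sym
    proper′ (old _) 0F      refl = not-¬ refl
    proper′ (old _) 2F      refl = not-¬ refl
    proper′ (old x) (old y) a    = proper x y a

  attach-bridgeless : Connected G → Bridgeless G → Bridgeless attach
  attach-bridgeless connected bridgeless =
    detours⇒bridgeless attach (attach-connected connected) detour
    where
    detour₀₁ : Detour attach 0F 1F
    detour₀₁ = keep attach {y = old h} refl ◅ keep attach {y = 2F} refl ◅ keep attach tt ◅ ε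
    detour₁₂ : Detour attach 1F 2F
    detour₁₂ = keep attach {y = 0F} tt ◅ keep attach {y = old h} refl ◅ keep attach refl ◅ ε
    detour₀ₕ : Detour attach 0F (old h)
    detour₀ₕ = keep attach {y = 1F} tt ◅ keep attach {y = 2F} tt ◅ keep attach refl ◅ ε
    detour₂ₕ : Detour attach 2F (old h)
    detour₂ₕ = keep attach {y = 1F} tt ◅ keep attach {y = 0F} tt ◅ keep attach refl ◅ ε
    detour : ∀ u v → A u v → Detour attach u v
    detour 0F      1F      _    = detour₀₁
    detour 0F      (old _) refl = detour₀ₕ
    detour 1F      0F      _    = detour-sym attach detour₀₁
    detour 1F      2F      _    = detour₁₂
    detour 2F      1F      _    = detour-sym attach detour₁₂
    detour 2F      (old _) refl = detour₂ₕ
    detour (old _) 0F      refl = detour-sym attach detour₀ₕ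
    detour (old _) 2F      refl = detour-sym attach detour₂ₕ
    detour (old x) (old y) x~y  = gmap (λ z → old z)
      (λ { (a , ne) → a , λ { (inj₁ (refl , refl)) → ne (inj₁ (refl , refl))
                            ; (inj₂ (refl , refl)) → ne (inj₂ (refl , refl)) } })
      (bridgeless x y x~y x y)

  IsNew : Fin (3 + n) → Set
  IsNew (old _) = ⊥
  IsNew _       = ⊤

  isNew? : ∀ x → Dec (IsNew x)
  isNew? 0F      = yes tt
  isNew? 1F      = yes tt
  isNew? 2F      = yes tt
  isNew? (old _) = no λ ()

  -- The edge set of the added cycle, described without reference to any `Cycle`, so that two cycles
  -- can be compared by comparing each of them with it.
  NewEdge : Rel (Fin (3 + n)) 0ℓ
  NewEdge x y = A x y × (IsNew x ⊎ IsNew y)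

  -- The new vertices have degree two, so a cycle meeting one of them must
  -- run through all of them and then through h.
  module _ (C : Cycle attach) where

    new-path : ∀ {z} → z ∈ vertices C → IsNew z →
               LiesOn 1F 0F C × LiesOn 1F 2F C × LiesOn 0F (old h) C × LiesOn 2F (old h) C
    new-path {z} z∈ new =
      proj₁ from₁ , proj₂ from₁ ,
      proj₂ (degree-two C (liesOn⇒∈ C (swap (proj₁ from₁))) only₀) ,
      proj₂ (degree-two C (liesOn⇒∈ C (swap (proj₂ from₁))) only₂)
      where
      only₀ : ∀ c → A 0F c → c ≡ 1F ⊎ c ≡ old h
      only₀ 1F      _    = inj₁ refl
      only₀ (old _) refl = inj₂ refl
      only₁ : ∀ c → A 1F c → c ≡ 0F ⊎ c ≡ 2F
      only₁ 0F _ = inj₁ refl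
      only₁ 2F _ = inj₂ refl
      only₂ : ∀ c → A 2F c → c ≡ 1F ⊎ c ≡ old h
      only₂ 1F      _    = inj₁ refl
      only₂ (old _) refl = inj₂ refl
      one∈ : ∀ {z} → z ∈ vertices C → IsNew z → 1F ∈ vertices C
      one∈ {0F} z∈ _ = liesOn⇒∈ C (swap (proj₁ (degree-two C z∈ only₀)))
      one∈ {1F} z∈ _ = z∈
      one∈ {2F} z∈ _ = liesOn⇒∈ C (swap (proj₁ (degree-two C z∈ only₂)))
      from₁ : LiesOn 1F 0F C × LiesOn 1F 2F C
      from₁ = degree-two C (one∈ z∈ new) only₁

    -- At `h` both edges of `C` are already taken by `0F` and `2F`, so `C` cannot escape into the
    -- old graph; `spread` then confines it to `h` and the new vertices.
    liesOn⇔newEdge : ∀ {z} → z ∈ vertices C → IsNew z → ∀ x y → LiesOn x y C ⇔ NewEdge x y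
    liesOn⇔newEdge {z} z∈ new x y
      with l₁₀ , l₁₂ , l₀ₕ , l₂ₕ ← new-path z∈ new
      = mk⇔ (λ xy → edge (spread C next z∈ (inj₁ new) (liesOn⇒∈ C xy)) xy) (on x y)
      where
      S : Fin (3 + n) → Set
      S x = IsNew x ⊎ x ≡ old h
      edge : ∀ {x y} → S x → LiesOn x y C → NewEdge x y
      edge (inj₁ new) xy  = liesOn⇒adj C xy , inj₁ new
      edge (inj₂ refl) xy with at-most-two C (λ ()) (swap l₀ₕ) (swap l₂ₕ) xy
      ... | inj₁ refl = refl , inj₂ tt
      ... | inj₂ refl = refl , inj₂ tt
      target : ∀ x y → S x → NewEdge x y → S y
      target x      0F      _ _          = inj₁ tt
      target x      1F      _ _          = inj₁ tt
      target x      2F      _ _          = inj₁ tt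
      target 0F     (old _) _ (refl , _) = inj₂ refl
      target 2F     (old _) _ (refl , _) = inj₂ refl
      target (old _) (old _) _ (_ , inj₁ ())
      target (old _) (old _) _ (_ , inj₂ ())
      next : ∀ {x y} → LiesOn x y C → S x → S y
      next {x} {y} xy Sx = target x y Sx (edge Sx xy)
      on : ∀ x y → NewEdge x y → LiesOn x y C
      on 0F      1F      _                 = swap l₁₀
      on 0F      (old _) (refl , _)        = l₀ₕ
      on 1F      0F      _                 = l₁₀
      on 1F      2F      _                 = l₁₂
      on 2F      1F      _                 = swap l₁₂
      on 2F      (old _) (refl , _)        = l₂ₕ
      on (old _) 0F      (refl , _)        = swap l₀ₕ
      on (old _) 2F      (refl , _)        = swap l₂ₕ
      on (old _) (old _) (_ , inj₁ ())
      on (old _) (old _) (_ , inj₂ ())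

  attach-cactus : IsCactus G → IsCactus attach
  attach-cactus cactus = record
    { connected         = attach-connected (IsCactus.connected cactus)
    ; at-most-one-cycle = λ u v _ → unique
    }
    where
    new-vertex : ∀ (C : Cycle attach) {x y} → LiesOn x y C → NewEdge x y → ∃ λ z → z ∈ vertices C × IsNew z
    new-vertex C xy (_ , inj₁ new) = _ , liesOn⇒∈ C xy , new
    new-vertex C xy (_ , inj₂ new) = _ , liesOn⇒∈ C (swap xy) , new
    -- As an edge of `C` the shared edge has a new end, and this end lies on `D` as well. Hence the
    -- edges of both cycles are exactly the new ones.
    both-new : ∀ {u v} (C D : Cycle attach) {z} → z ∈ vertices C → IsNew z →
               LiesOn u v C → LiesOn u v D → SameCycle C D
    both-new {u} {v} C D z∈ new uvC uvD x y
      with _ , z′∈ , new′ ← new-vertex D uvD (Equivalence.to (liesOn⇔newEdge C z∈ new u v) uvC)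
      = mk⇔ (Equivalence.from (liesOn⇔newEdge D z′∈ new′ x y) ∘ Equivalence.to (liesOn⇔newEdge C z∈ new x y))
            (Equivalence.from (liesOn⇔newEdge C z∈ new x y) ∘ Equivalence.to (liesOn⇔newEdge D z′∈ new′ x y))
    all-old : ∀ {xs} → ¬ Any.Any IsNew xs → All (λ z → ∃ λ x → old x ≡ z) xs
    all-old none = All.map old-vertex (All.¬Any⇒All¬ _ none)
      where
      old-vertex : ∀ {z} → ¬ IsNew z → ∃ λ x → old x ≡ z
      old-vertex {0F}    ¬new = contradiction tt ¬new
      old-vertex {1F}    ¬new = contradiction tt ¬new
      old-vertex {2F}    ¬new = contradiction tt ¬new
      old-vertex {old x} ¬new = x , refl
    unique : ∀ {u v} (C D : Cycle attach) → LiesOn u v C → LiesOn u v D → SameCycle C D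
    unique C D uvC uvD with Any.any? isNew? (vertices C) | Any.any? isNew? (vertices D)
    ... | yes new | _ = let _ , z∈ , new′ = find new in both-new C D z∈ new′ uvC uvD
    ... | no _ | yes new = let _ , z∈ , new′ = find new in
            sameCycle-sym {C = D} {C} (both-new D C z∈ new′ uvD uvC)
    ... | no oldC | no oldD = at-most-one-cycle-in-image {G = G} (λ x → old x)
            (λ { refl → refl }) id cactus C D (all-old oldC) (all-old oldD) uvC uvD

-- Even cycles

alternating : ℕ → Bool
alternating zero    = true
alternating (suc k) = not (alternating k)

alternating-even : ∀ {k} → 2 ∣ k → alternating k ≡ true
alternating-even (divides-refl q) = go q
  where
  go : ∀ q → alternating (q * 2) ≡ true
  go zero    = refl
  go (suc q) = trans (not-involutive _) (go q)

module CycleGraph (k : ℕ) where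

  private
    top : Fin (3 + k)
    top = fromℕ (2 + k)

    prev : Fin (3 + k) → Fin (3 + k)
    prev zero    = top
    prev (suc i) = inject₁ i

    next : Fin (3 + k) → Fin (3 + k)
    next i with view i
    ... | ‵fromℕ     = zero
    ... | ‵inject₁ j = suc j

    next-prev : ∀ i → next (prev i) ≡ i
    next-prev zero    rewrite view-fromℕ (2 + k) = refl
    next-prev (suc i) rewrite view-inject₁ i     = refl

    prev-next : ∀ i → prev (next i) ≡ i
    prev-next i with view i
    ... | ‵fromℕ     = refl
    ... | ‵inject₁ j = refl

    inject₁≢suc : ∀ {m} {i j : Fin m} → toℕ i ≤ toℕ j → inject₁ i ≢ suc j
    inject₁≢suc {i = i} i≤j e =
      <-irrefl (trans (sym (toℕ-inject₁ i)) (cong toℕ e)) (s≤s i≤j)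

    prev≢ : ∀ i → prev i ≢ i
    prev≢ (suc i) = inject₁≢suc ≤-refl

    -- This is where a length of at least three matters: on two vertices `prev` would be an
    -- involution and the two neighbours would coincide.
    prev-prev≢ : ∀ i → prev (prev i) ≢ i
    prev-prev≢ (suc zero)    ()
    prev-prev≢ (suc (suc i)) e =
      inject₁≢suc {i = inject₁ i} {suc i} (≤-trans (≤-reflexive (toℕ-inject₁ i)) (n≤1+n _)) e

    next≢prev : ∀ i → next i ≢ prev i
    next≢prev i e = prev-prev≢ i (trans (cong prev (sym e)) (prev-next i))

    next≢ : ∀ i → next i ≢ i
    next≢ i e = prev≢ i (trans (cong prev (sym e)) (prev-next i))

    A : Rel (Fin (3 + k)) 0ℓ
    A i j = j ≡ next i ⊎ j ≡ prev i

    A-sym : ∀ {i j} → A i j → A j i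
    A-sym (inj₁ refl) = inj₂ (sym (prev-next _))
    A-sym (inj₂ refl) = inj₁ (sym (next-prev _))

    prev-edge : ∀ i → A i (prev i)
    prev-edge i = inj₂ refl

  cycleGraph : SimpleGraph (3 + k)
  cycleGraph = record
    { Adj    = A
    ; adj?   = λ i j → j ≟ next i ⊎-dec j ≟ prev i
    ; symm   = A-sym
    ; irrefl = λ { {i} refl → [ next≢ i ∘ sym , prev≢ i ∘ sym ]′ }
    }

  cycleGraph-degree : ∀ i → degree cycleGraph i ≡ 2
  cycleGraph-degree i = begin
    degree cycleGraph i
      ≡⟨ degree-sum cycleGraph i ⟩
    sum (λ j → 𝟙 (j ≟ next i ⊎-dec j ≟ prev i))
      ≡⟨ sum-cong-≗ (λ j → 𝟙-⊎ (j ≟ next i ⊎-dec j ≟ prev i) (j ≟ next i) (j ≟ prev i)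
           id inj₁ inj₂ λ { refl → next≢prev i }) ⟩
    sum (λ j → 𝟙 (j ≟ next i) + 𝟙 (j ≟ prev i))
      ≡⟨ ∑-distrib-+ (λ j → 𝟙 (j ≟ next i)) (λ j → 𝟙 (j ≟ prev i)) ⟩
    sum (λ j → 𝟙 (j ≟ next i)) + sum (λ j → 𝟙 (j ≟ prev i))
      ≡⟨ cong₂ _+_ (sum-𝟙-≡ (next i)) (sum-𝟙-≡ (prev i)) ⟩
    2 ∎
    where open ≡-Reasoning

  cycleGraph-connected : Connected cycleGraph
  cycleGraph-connected u v = down u ◅◅ Star.reverse A-sym (down v)
    where
    down : ∀ i → Star A i zero
    down = <-weakInduction (λ i → Star A i zero) ε (λ i s → prev-edge (suc i) ◅ s)

  -- All degrees are two, so a cycle contains every edge at each of its vertices and, by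
  -- connectedness, every edge of the graph. Hence any two cycles have the same edge set.
  cycleGraph-cactus : IsCactus cycleGraph
  cycleGraph-cactus = record
    { connected         = cycleGraph-connected
    ; at-most-one-cycle = λ _ _ _ C D _ _ x y →
        mk⇔ (all-edges D ∘ liesOn⇒adj C) (all-edges C ∘ liesOn⇒adj D)
    }
    where
    edges-at : (C : Cycle cycleGraph) → ∀ {x y} → x ∈ vertices C → A x y → LiesOn x y C
    edges-at C x∈ (inj₁ refl) = proj₁ (degree-two C x∈ (λ _ → id))
    edges-at C x∈ (inj₂ refl) = proj₂ (degree-two C x∈ (λ _ → id))
    reached : (C : Cycle cycleGraph) → ∀ {x y} → Star A x y → x ∈ vertices C → y ∈ vertices C
    reached C ε        x∈ = x∈
    reached C (a ◅ as) x∈ = reached C as (liesOn⇒∈ C (swap (edges-at C x∈ a)))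
    all-edges : (C : Cycle cycleGraph) → ∀ {x y} → A x y → LiesOn x y C
    all-edges C a = edges-at C (reached C (cycleGraph-connected _ _) (here refl)) a

  cycleGraph-bipartite : 2 ∣ 3 + k → Bipartite cycleGraph
  cycleGraph-bipartite even = colour , λ where
      u _ (inj₂ refl) → proper u
      u _ (inj₁ refl) e → proper (next u) (trans (sym e) (cong colour (sym (prev-next u))))
    where
    colour : Fin (3 + k) → Bool
    colour i = alternating (toℕ i)
    proper : ∀ i → colour i ≢ colour (prev i)
    -- The closing edge between `zero` and `top` is the only one at which the parity of the length
    -- enters.
    proper zero e = contradiction (begin
      true                        ≡⟨ alternating-even even ⟨
      not (alternating (2 + k))   ≡⟨ cong (not ∘ alternating) (toℕ-fromℕ (2 + k)) ⟨
      not (colour top)            ≡⟨ cong not e ⟨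
      false                       ∎) λ ()
      where open ≡-Reasoning
    proper (suc i) e = not-¬ refl (trans (cong alternating (sym (toℕ-inject₁ i))) (sym e))

  cycleGraph-bridgeless : Bridgeless cycleGraph
  cycleGraph-bridgeless = detours⇒bridgeless cycleGraph cycleGraph-connected λ where
      u _ (inj₂ refl) → detour u
      u _ (inj₁ refl) → detour-sym cycleGraph
        (subst (Detour cycleGraph (next u)) (prev-next u) (detour (next u)))
    where
    suc-edge : ∀ i → A (inject₁ i) (suc i)
    suc-edge i = A-sym (prev-edge (suc i))
    detour : ∀ i → Detour cycleGraph i (prev i)
    detour zero = <-weakInduction (Star R zero) ε (λ i s → s ◅◅ (suc-edge i , avoid i) ◅ ε) top
      where
      R = Adj (deleteEdge cycleGraph zero top)
      avoid : ∀ i → ¬ SameEdge zero top (inject₁ i) (suc i)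
      avoid zero    (inj₁ (_ , ()))
      avoid zero    (inj₂ (() , _))
      avoid (suc _) (inj₁ (() , _))
      avoid (suc _) (inj₂ (() , _))
    -- The long way round: up to `top`, across the closing edge to `zero`, then up to `inject₁ j`.
    -- Of the upward steps from `inject₁ i` to `suc i` only the one with `i ≡ j` is the deleted
    -- edge.
    detour (suc j) = to-top (suc j) (s≤s ≤-refl) ◅◅ (A-sym (prev-edge zero) , top-zero j) ◅
                     from-zero (inject₁ j) (≤-reflexive (toℕ-inject₁ j))
      where
      R = Adj (deleteEdge cycleGraph (suc j) (inject₁ j))
      avoid : ∀ i → i ≢ j → ¬ SameEdge (suc j) (inject₁ j) (inject₁ i) (suc i)
      avoid i i≢j (inj₁ (e , e′)) = contradiction (trans (cong toℕ e′) (toℕ-inject₁ j))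
        (λ si≡j → <⇒≢ (m<n⇒m<1+n (≤-reflexive si≡j)) (trans (sym (toℕ-inject₁ i)) (cong toℕ e)))
      avoid i i≢j (inj₂ (refl , _)) = i≢j refl
      top-zero : ∀ j → ¬ SameEdge (suc j) (inject₁ j) top zero
      top-zero zero    (inj₁ (() , _))
      top-zero (suc _) (inj₁ (_ , ()))
      to-top : ∀ i → toℕ j < toℕ i → Star R i top
      to-top = >-weakInduction (λ i → toℕ j < toℕ i → Star R i top) (λ _ → ε)
        λ i rec j<i → let j<i = subst (toℕ j <_) (toℕ-inject₁ i) j<i in
          (suc-edge i , avoid i (λ { refl → <-irrefl refl j<i })) ◅ rec (m<n⇒m<1+n j<i)
      from-zero : ∀ i → toℕ i ≤ toℕ j → Star R zero i
      from-zero = <-weakInduction (λ i → toℕ i ≤ toℕ j → Star R zero i) (λ _ → ε)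
        λ i rec i<j → rec (≤-trans (≤-reflexive (toℕ-inject₁ i)) (<⇒≤ i<j)) ◅◅
          (suc-edge i , avoid i (λ { refl → <-irrefl refl i<j })) ◅ ε

-- Realising sorted excess sequences

module Reverse {n : ℕ} (G : SimpleGraph n) where

  reversed : SimpleGraph n
  reversed = record
    { Adj    = λ x y → Adj G (opposite x) (opposite y)
    ; adj?   = λ x y → adj? G (opposite x) (opposite y)
    ; symm   = symm G
    ; irrefl = λ { refl → irrefl G refl }
    }

  private
    lift-star : {R S : Rel (Fin n) 0ℓ} → (∀ {x y} → R x y → S (opposite x) (opposite y)) →
                ∀ {x y} → Star R (opposite x) (opposite y) → Star S x y
    lift-star {S = S} R⇒S {x} {y} s =
      subst₂ (Star S) (opposite-involutive x) (opposite-involutive y) (gmap opposite R⇒S s)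

    adj-lift : ∀ {x y} → Adj G x y → Adj reversed (opposite x) (opposite y)
    adj-lift = subst₂ (Adj G) (sym (opposite-involutive _)) (sym (opposite-involutive _))

    opposite-injective : ∀ {x y : Fin n} → opposite x ≡ opposite y → x ≡ y
    opposite-injective {x} {y} e =
      trans (sym (opposite-involutive x)) (trans (cong opposite e) (opposite-involutive y))

  reversed-degree : ∀ i → degree reversed i ≡ degree G (opposite i)
  reversed-degree i = begin
    degree reversed i
      ≡⟨ degree-sum reversed i ⟩
    sum (λ j → 𝟙 (adj? G (opposite i) (opposite j)))
      ≡⟨ sum-permute (λ j → 𝟙 (adj? G (opposite i) j)) reverse ⟨
    sum (λ j → 𝟙 (adj? G (opposite i) j))
      ≡⟨ degree-sum G (opposite i) ⟨
    degree G (opposite i) ∎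
    where open ≡-Reasoning

  reversed-connected : Connected G → Connected reversed
  reversed-connected connected u v = lift-star adj-lift (connected (opposite u) (opposite v))

  reversed-cactus : IsCactus G → IsCactus reversed
  reversed-cactus cactus = record
    { connected         = reversed-connected (IsCactus.connected cactus)
    ; at-most-one-cycle = λ _ _ _ C D → at-most-one-cycle-in-image {G = G} {G′ = reversed}
        opposite opposite-injective
        (subst₂ (Adj G) (opposite-involutive _) (opposite-involutive _)) cactus C D (image C) (image D)
    }
    where
    image : (C : Cycle reversed) → All (λ z → ∃ λ x → opposite x ≡ z) (vertices C)
    image C = All.tabulate λ {z} _ → opposite z , opposite-involutive z

  reversed-bridgeless : Bridgeless G → Bridgeless reversed
  reversed-bridgeless bridgeless u v u~v x y =
    lift-star (λ (a , ne) → adj-lift a , λ { (inj₁ (e , e′)) → ne (inj₁ (flip-≡ e , flip-≡ e′))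
                                           ; (inj₂ (e , e′)) → ne (inj₂ (flip-≡ e , flip-≡ e′)) })
      (bridgeless (opposite u) (opposite v) u~v (opposite x) (opposite y))
    where
    flip-≡ : ∀ {x y : Fin n} → opposite x ≡ y → x ≡ opposite y
    flip-≡ {x} e = trans (sym (opposite-involutive x)) (cong opposite e)

  reversed-bipartite : Bipartite G → Bipartite reversed
  reversed-bipartite (colour , proper) = colour ∘ opposite , λ u v → proper (opposite u) (opposite v)

sum≡0⇒≡0 : ∀ {n} (f : Fin n → ℕ) → sum f ≡ 0 → ∀ i → f i ≡ 0
sum≡0⇒≡0 f e zero    = m+n≡0⇒m≡0 (f zero) e
sum≡0⇒≡0 f e (suc i) = sum≡0⇒≡0 (f ∘ suc) (m+n≡0⇒n≡0 (f zero) e) i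

first-positive : ∀ {n} (f : Fin n → ℕ) → 1 ≤ sum f →
                 ∃ λ h → 1 ≤ f h × (∀ {i} → i Fin.< h → f i ≡ 0)
first-positive {suc n} f 1≤ with f zero in e
... | suc _ = zero , subst (1 ≤_) (sym e) (s≤s z≤n) , λ ()
... | zero with h , 1≤fh , below ← first-positive (f ∘ suc) 1≤ =
  suc h , 1≤fh , λ { {zero} _ → e ; {suc i} (s≤s lt) → below lt }

Nondecreasing : ∀ {n} → (Fin n → ℕ) → Set
Nondecreasing f = ∀ {i j} → i Fin.≤ j → f i ≤ f j

BridgelessBipartiteCactus : ∀ {n} → SimpleGraph n → Set
BridgelessBipartiteCactus G = IsCactus G × Bridgeless G × Bipartite G

module _ {n : ℕ} (g : Fin n → ℕ) {h : Fin n} (1≤gh : 1 ≤ g h) where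

  decrement : Fin n → ℕ
  decrement x = g x ∸ 𝟙 (x ≟ h)

  decrement-+ : ∀ x → 𝟙 (x ≟ h) + decrement x ≡ g x
  decrement-+ x with x ≟ h
  ... | yes refl = m+[n∸m]≡n 1≤gh
  ... | no _     = refl

  decrement-sum : suc (sum decrement) ≡ sum g
  decrement-sum = begin
    suc (sum decrement)
      ≡⟨ cong (_+ sum decrement) (sum-𝟙-≡ h) ⟨
    sum (λ x → 𝟙 (x ≟ h)) + sum decrement
      ≡⟨ ∑-distrib-+ (λ x → 𝟙 (x ≟ h)) decrement ⟨
    sum (λ x → 𝟙 (x ≟ h) + decrement x)
      ≡⟨ sum-cong-≗ decrement-+ ⟩
    sum g ∎
    where open ≡-Reasoning

  -- Only zeros precede the first positive entry, so lowering that entry by one cannot disturb the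
  -- order.
  decrement-nondecreasing : Nondecreasing g → (∀ {i} → i Fin.< h → g i ≡ 0) → Nondecreasing decrement
  decrement-nondecreasing mono below {i} {j} i≤j with i ≟ h | j ≟ h
  ... | yes refl | yes refl = ≤-refl
  ... | yes refl | no _     = ≤-trans (m∸n≤m (g h) 1) (mono i≤j)
  ... | no i≢h   | yes refl = ≤-trans (≤-reflexive (below (Fin.≤∧≢⇒< i≤j i≢h))) z≤n
  ... | no _     | no _     = mono i≤j

dropThree : ∀ {n} → (Fin (3 + n) → ℕ) → Fin n → ℕ
dropThree f x = f (old x)

-- Otherwise every entry from 2F on would be positive, forcing the sum above n.
leading-zeros : ∀ {n q} (f : Fin (3 + n) → ℕ) → Nondecreasing f → sum f ≡ suc q → q < n →
                f 0F ≡ 0 × f 1F ≡ 0 × f 2F ≡ 0 × sum (dropThree f) ≡ suc q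
leading-zeros {n} {q} f mono sum≡ q<n = f0≡0 , f1≡0 , f2≡0 ,
  trans (sym (cong₂ _+_ f0≡0 (cong₂ _+_ f1≡0 (cong (_+ sum (dropThree f)) f2≡0)))) sum≡
  where
  open ≤-Reasoning
  f2≡0 : f 2F ≡ 0
  f2≡0 with f 2F ≤? 0
  ... | yes f2≤0 = n≤0⇒n≡0 f2≤0
  ... | no f2≰0  = contradiction (begin-strict
    suc q                                              <⟨ s<s q<n ⟩
    suc n                                              ≡⟨ cong suc (trans (sum-const n 1) (*-identityʳ n)) ⟨
    1 + sum {n} (λ _ → 1)                              ≤⟨ +-mono-≤ 0<f2 (sum-mono {n} {λ _ → 1} {dropThree f} (λ x → ≤-trans 0<f2 (mono {2F} {old x} (s≤s (s≤s z≤n))))) ⟩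
    f 2F + sum (dropThree f)                       ≤⟨ m≤n+m _ (f 1F) ⟩
    f 1F + (f 2F + sum (dropThree f))              ≤⟨ m≤n+m _ (f 0F) ⟩
    sum f                                              ≡⟨ sum≡ ⟩
    suc q                                              ∎) (<-irrefl refl)
    where
    0<f2 : 0 < f 2F
    0<f2 = ≰⇒> f2≰0
  f0≡0 : f 0F ≡ 0
  f0≡0 = n≤0⇒n≡0 (≤-trans (mono z≤n) (≤-reflexive f2≡0))
  f1≡0 : f 1F ≡ 0
  f1≡0 = n≤0⇒n≡0 (≤-trans (mono (s≤s z≤n)) (≤-reflexive f2≡0))

-- Attaching puts the new vertices first, so the excesses run in nondecreasing
-- order, opposite to the degree sequence.
excess-realization : ∀ q L → 3 ≤ L → 2 ∣ L → (f : Fin (q * 3 + L) → ℕ) → Nondecreasing f → sum f ≡ q →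
  ∃ λ G → (∀ i → degree G i ≡ 2 * suc (f i)) × BridgelessBipartiteCactus G
excess-realization zero (suc (suc (suc k))) _ even f mono sum≡0 =
  cycleGraph , (λ i → trans (cycleGraph-degree i) (cong (λ e → 2 * suc e) (sym (sum≡0⇒≡0 f sum≡0 i)))) ,
  cycleGraph-cactus , cycleGraph-bridgeless , cycleGraph-bipartite even
  where open CycleGraph k
excess-realization zero (suc zero) (s≤s ())
excess-realization zero (suc (suc zero)) (s≤s (s≤s ()))
-- `suc q * 3 + L` unfolds to `3 + (q * 3 + L)`: the three leading vertices form the new part of the
-- last attached cycle, and the others carry the graph from the recursive call.
excess-realization (suc q) L 3≤L even f mono sum≡
  with f0≡0 , f1≡0 , f2≡0 , sum-old ← leading-zeros f mono sum≡
         (≤-trans (≤-reflexive (+-comm 1 q)) (+-mono-≤ (m≤m*n q 3) (≤-trans (s≤s z≤n) 3≤L)))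
  with h , 1≤gh , below ← first-positive (dropThree f) (subst (1 ≤_) (sym sum-old) (s≤s z≤n))
  with H , deg , cactus , bridgeless , bipartite ←
    excess-realization q L 3≤L even (decrement (dropThree f) 1≤gh)
      (decrement-nondecreasing (dropThree f) 1≤gh (λ i≤j → mono (s≤s (s≤s (s≤s i≤j)))) below)
      (suc-injective (trans (decrement-sum (dropThree f) 1≤gh) sum-old))
  = let open Attach H h
        deg′ : ∀ i → degree attach i ≡ 2 * suc (f i)
        deg′ = λ where
          0F      → trans attach-degree-0 (cong (λ e → 2 * suc e) (sym f0≡0))
          1F      → trans attach-degree-1 (cong (λ e → 2 * suc e) (sym f1≡0))
          2F      → trans attach-degree-2 (cong (λ e → 2 * suc e) (sym f2≡0))
          (old x) → trans (attach-degree-old x) (trans (cong (2 * 𝟙 (x ≟ h) +_) (deg x))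
                      (trans (regroup (𝟙 (x ≟ h)) (decrement (dropThree f) 1≤gh x))
                             (cong (λ e → 2 * suc e) (decrement-+ (dropThree f) 1≤gh x))))
    in attach , deg′ , attach-cactus cactus , attach-bridgeless (IsCactus.connected cactus) bridgeless ,
       attach-bipartite bipartite
  where
  regroup : ∀ a b → 2 * a + 2 * suc b ≡ 2 * suc (a + b)
  regroup = solve-∀

sorted-realization : ∀ {n} q L → 3 ≤ L → 2 ∣ L → q * 3 + L ≡ n → (e : Fin n → ℕ) →
  (∀ {i j} → i Fin.≤ j → e j ≤ e i) → sum e ≡ q →
  ∃ λ (G : SimpleGraph n) → (∀ i → degree G i ≡ 2 * suc (e i)) × BridgelessBipartiteCactus G
sorted-realization q L 3≤L even refl e mono sum≡
  with G , deg , cactus , bridgeless , bipartite ←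
    excess-realization q L 3≤L even (e ∘ opposite)
      (λ {i} {j} i≤j → mono (subst₂ _≤_ (sym (opposite-prop j)) (sym (opposite-prop i))
                                        (∸-monoʳ-≤ (q * 3 + L) (s≤s i≤j))))
      (trans (sym (sum-permute e reverse)) sum≡)
  = reversed ,
    (λ i → trans (reversed-degree i) (trans (deg (opposite i))
             (cong (λ j → 2 * suc (e j)) (opposite-involutive i)))) ,
    reversed-cactus cactus , reversed-bridgeless bridgeless , reversed-bipartite bipartite
  where open Reverse G

-- Edge arithmetic and the equivalence

halfSum-double : ∀ {n} (d : Vec ℕ n) {m} → sum (lookup d) ≡ 2 * m → halfSum d ≡ m
halfSum-double d {m} e = begin
  Vec.sum d / 2 ≡⟨ cong (_/ 2) (trans (sum-lookup d) (trans e (*-comm 2 m))) ⟩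
  m * 2 / 2     ≡⟨ m*n/n≡m m 2 ⟩
  m             ∎
  where open ≡-Reasoning

-- Here `n` is one less than the number of vertices. Writing m = 2k before rounding reduces the
-- bound to 3k ≤ 2n; rounding down for `k` instead of `m` puts the factor 2 outside the floor.
even-edge-bound : ∀ {m n} → 2 ∣ m → 3 * m + 4 ≤ 4 * suc n → m ≤ 2 * (2 * n / 3)
even-edge-bound {n = n} (divides-refl k) bound = begin
  k * 2             ≡⟨ *-comm k 2 ⟩
  2 * k             ≡⟨ cong (2 *_) (m*n/n≡m k 3) ⟨
  2 * (k * 3 / 3)   ≤⟨ *-monoʳ-≤ 2 3k/3≤ ⟩
  2 * (2 * n / 3)   ∎
  where
  open ≤-Reasoning
  expand : ∀ k → 3 * (k * 2) + 4 ≡ 2 * (k * 3) + 4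
  expand = solve-∀
  expand′ : ∀ n → 4 * suc n ≡ 2 * (2 * n) + 4
  expand′ = solve-∀
  6k≤4n : 2 * (k * 3) ≤ 2 * (2 * n)
  6k≤4n = +-cancelʳ-≤ 4 _ _ (subst₂ _≤_ (expand k) (expand′ n) bound)
  3k≤2n : k * 3 ≤ 2 * n
  3k≤2n = *-cancelˡ-≤ 2 6k≤4n
  3k/3≤ : k * 3 / 3 ≤ 2 * n / 3
  3k/3≤ = /-monoˡ-≤ 3 3k≤2n

theorem5p5 : (n : ℕ) → 4 ≤ n → (d : Vec ℕ n) → IsDegreeSequence d →
    (∃ λ (G : SimpleGraph n) → Realizes G d × IsCactus G × Bridgeless G × Bipartite G)
    ⇔
    (halfSum d ≤ 2 * ((2 * (n ∸ 1)) / 3) × 2 ∣ halfSum d × (∀ i → 2 ∣ lookup d i))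
theorem5p5 (suc n) _ d isDegreeSequence = mk⇔ necessary sufficient
  where
  necessary : (∃ λ (G : SimpleGraph (suc n)) → Realizes G d × IsCactus G × Bridgeless G × Bipartite G) →
              halfSum d ≤ 2 * ((2 * n) / 3) × 2 ∣ halfSum d × (∀ i → 2 ∣ lookup d i)
  necessary (G , realizes , cactus , bridgeless , bipartite) =
    let m , total , bound = BreadthFirst.cactus-edge-bound G (IsCactus.connected cactus) bipartite zero cactus
        m′ , total′ , 2∣m′ = bipartite-edges-even {G = G} bipartite (cactus-degree-even cactus bridgeless)
        m≡m′ = *-cancelˡ-≡ m m′ 2 (trans (sym total) total′)
        halfSum≡m = halfSum-double d (trans (sum-cong-≗ (sym ∘ realizes)) total)
        2∣halfSum = subst (2 ∣_) (sym (trans halfSum≡m m≡m′)) 2∣m′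
    in  even-edge-bound 2∣halfSum (subst (λ m → 3 * m + 4 ≤ 4 * suc n) (sym halfSum≡m) bound) ,
        2∣halfSum , λ i → subst (2 ∣_) (realizes i) (cactus-degree-even cactus bridgeless i)

  sufficient : halfSum d ≤ 2 * ((2 * n) / 3) × 2 ∣ halfSum d × (∀ i → 2 ∣ lookup d i) →
               ∃ λ (G : SimpleGraph (suc n)) → Realizes G d × IsCactus G × Bridgeless G × Bipartite G
  sufficient (bound , divides k m≡2k , even) =
    let G , deg , good = sorted-realization q L 3≤L 2∣L q*3+L≡ e e-mono refl
    in  G , (λ i → trans (deg i) (sym (e-spec i))) , good
    where
    half : ∀ {x} → 1 ≤ x → 2 ∣ x → ∃ λ e → x ≡ 2 * suc e
    half () (divides-refl zero)
    half _  (divides-refl (suc e)) = e , *-comm (suc e) 2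
    -- A vertex of degree `2 * suc (e i)` lies on `suc (e i)` cycles of the cactus; the excess
    -- counts those beyond the first.
    e : Fin (suc n) → ℕ
    e i = proj₁ (half (IsDegreeSequence.positive isDegreeSequence i) (even i))
    e-spec : ∀ i → lookup d i ≡ 2 * suc (e i)
    e-spec i = proj₂ (half (IsDegreeSequence.positive isDegreeSequence i) (even i))
    e-mono : ∀ {i j} → i Fin.≤ j → e j ≤ e i
    e-mono {i} {j} i≤j = s≤s⁻¹ (*-cancelˡ-≤ 2 (subst₂ _≤_ (e-spec j) (e-spec i)
                           (IsDegreeSequence.nonincreasing isDegreeSequence i≤j)))
    q L : ℕ
    q = sum e
    L = suc n ∸ q * 3
    m≡n+q : halfSum d ≡ suc n + q
    m≡n+q = halfSum-double d (begin
      sum (lookup d)                        ≡⟨ sum-cong-≗ e-spec ⟩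
      sum (λ i → 2 * suc (e i))             ≡⟨ *-distribˡ-sum 2 (λ i → suc (e i)) ⟨
      2 * sum (λ i → 1 + e i)               ≡⟨ cong (2 *_) (∑-distrib-+ {suc n} (λ _ → 1) e) ⟩
      2 * (sum {suc n} (λ _ → 1) + q)       ≡⟨ cong (λ s → 2 * (s + q))
                                                 (trans (sum-const (suc n) 1) (*-identityʳ (suc n))) ⟩
      2 * (suc n + q)                       ∎)
      where open ≡-Reasoning
    k≤ : k ≤ 2 * n / 3
    k≤ = *-cancelˡ-≤ 2 (≤-trans (≤-reflexive (trans (*-comm 2 k) (sym m≡2k))) bound)
    -- The bound on m gives 3m ≤ 4n, and m = n + 1 + q. As there are `suc n` vertices, at least four
    -- of them remain for the base cycle.
    3q+3≤n : q * 3 + 3 ≤ n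
    3q+3≤n = +-cancelˡ-≤ (3 * n) _ _ (begin
      3 * n + (q * 3 + 3)     ≡⟨ expand n q ⟩
      3 * (suc n + q)         ≡⟨ cong (3 *_) (trans (sym m≡n+q) m≡2k) ⟩
      3 * (k * 2)             ≡⟨ regroup k ⟩
      2 * (k * 3)             ≤⟨ *-monoʳ-≤ 2 (≤-trans (*-monoˡ-≤ 3 k≤) (m/n*n≤m (2 * n) 3)) ⟩
      2 * (2 * n)             ≡⟨ regroup′ n ⟩
      3 * n + n               ∎)
      where
      open ≤-Reasoning
      expand : ∀ n q → 3 * n + (q * 3 + 3) ≡ 3 * (suc n + q)
      expand = solve-∀
      regroup : ∀ k → 3 * (k * 2) ≡ 2 * (k * 3)
      regroup = solve-∀
      regroup′ : ∀ n → 2 * (2 * n) ≡ 3 * n + n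
      regroup′ = solve-∀
    q*3+L≡ : q * 3 + L ≡ suc n
    q*3+L≡ = m+[n∸m]≡n (≤-trans (m≤m+n (q * 3) 3) (≤-trans 3q+3≤n (n≤1+n n)))
    3≤L : 3 ≤ L
    3≤L = +-cancelˡ-≤ (q * 3) 3 L (≤-trans 3q+3≤n (≤-trans (n≤1+n n) (≤-reflexive (sym q*3+L≡))))
    -- The total m = 4q + L consists of four edges for each attached cycle and `L` for the base, so
    -- `L` has the parity of m.
    2∣L : 2 ∣ L
    2∣L = ∣m+n∣m⇒∣n (divides k (begin
      q * 2 * 2 + L         ≡⟨ regroup q L ⟩
      q * 3 + L + q         ≡⟨ cong (_+ q) q*3+L≡ ⟩
      suc n + q             ≡⟨ trans (sym m≡n+q) m≡2k ⟩
      k * 2                 ∎)) (divides (q * 2) refl)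
      where
      open ≡-Reasoning
      regroup : ∀ q L → q * 2 * 2 + L ≡ q * 3 + L + q
      regroup = solve-∀
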